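{- Let $f\colon\mathcal{E}_\infty\to\mathcal{E}_\infty$ be a Borel map. Then there exists a Ramsey conull set $\mathcal{C}\subseteq\mathcal{E}_\infty$ such that $f$ is tracial on $\mathcal{C}$.
   Context: $\mathcal{E}_\infty$ is the set of all equivalence relations on $\mathbb{N}=\{0,1,2,\ldots\}$ with infinitely many classes. For $A,B\in\mathcal{E}_\infty$ write $A\le B$ if every $A$-class is a union of $B$-classes. For $A\in\mathcal{E}_\infty$ let $\mu_0(A)<\mu_1(A)<\cdots$ be the increasing enumeration of the minima of the $A$-classes, and let $r_n(A)$ be the restriction of $A$ to $\{0,\ldots,\mu_n(A)-1\}$ (so $r_0(A)=\emptyset$). $\mathcal{E}_\infty^{\mathrm{fin}}$ is the set of all equivalence relations on initial segments $\{0,\ldots,k-1\}$ of $\mathbb{N}$; for $s\in\mathcal{E}_\infty^{\mathrm{fin}}$, $\mathrm{dom}(s)$ is the underlying set $\{0,\ldots,k-1\}$. $\mathcal{E}_\infty$ carries the Polish topology generated by the sets $\{A: r_n(A)=s\text{ for some }n\}$, $s\in\mathcal{E}_\infty^{\mathrm{fin}}$ (equivalently, inherited from $2^{\mathbb{N}\times\mathbb{N}}$), and "Borel" refers to this topology. For $s\in\mathcal{E}_\infty^{\mathrm{fin}}$ and $A\in\mathcal{E}_\infty$, $[s,A]=\{B\in\mathcal{E}_\infty: B\le A\text{ and } s=r_n(B)\text{ for some }n\}$. A set $\mathcal{C}\subseteq\mathcal{E}_\infty$ is Ramsey conull if its complement is Ramsey null, i.e. for every $[s,A]\neq\emptyset$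 there is $B\in[s,A]$ with $[s,B]\subseteq\mathcal{C}$. For $A,B\in\mathcal{E}_\infty$ and $n\in\mathbb{N}$, the trace $\mathrm{tr}(A,B,n)$ is the restriction of $A$ to $\{0,1,\ldots,\mu_n(B)-1\}$. A map $f\colon\mathcal{E}_\infty\to\mathcal{E}_\infty$ is tracial on $\mathcal{X}\subseteq\mathcal{E}_\infty$ if for every $B\in\mathcal{X}$ there is $n_0\in\mathbb{N}$ such that for all $n\ge n_0$ and all $A,A'\le B$ for which there exist $k\in\mathbb{N}$ and $s\in\mathcal{E}_\infty^{\mathrm{fin}}$ with $s=r_k(A)=r_k(A')$ and $\mathrm{dom}(s)=\{0,\ldots,\mu_n(B)-1\}$, we have $\mathrm{tr}(f(A),B,n)=\mathrm{tr}(f(A'),B,n)$. -}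

module Defs where

open import Data.Bool.Base using (Bool; T)
open import Data.Bool.Properties using (T?)
open import Data.Fin.Base using (Fin; toℕ; cast)
open import Data.List.Base using (List; upTo)
open import Data.List.Membership.Propositional using (lose)
open import Data.List.Membership.Propositional.Properties using (∈-upTo⁺)
import Data.List.Membership.Setoid as SetoidMembership
open import Data.Nat.Base using (ℕ; zero; suc; _≤_; _<_; z≤n; s≤s)
open import Data.Nat.Induction using (<-rec)
open import Data.Nat.Properties
open import Data.Product.Base using (Σ; Σ-syntax; ∃; ∃-syntax; _×_; _,_; proj₁; proj₂)
open import Function.Bundles using (_⟶ₛ_; module Func; _⇔_; mk⇔)
open import Level using (0ℓ) renaming (suc to lsuc)
open import Relation.Binary.Bundles using (Setoid)
open import Relation.Binary.Core using (Rel; _⇒_)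
open import Relation.Binary.PropositionalEquality
  using (_≡_; refl; sym; trans)
open import Relation.Binary.Structures using (IsEquivalence)
open import Relation.Nullary using (¬_; yes; no)
open import Relation.Nullary.Decidable using (map′; ¬?; _×-dec_)
open import Relation.Unary
  using (Pred; Decidable; _∈_; _⊆_; _≐_; _∩_; ∁; U; ⋃; _⊢_; Satisfiable)

-- Relations are given by their characteristic functions, that is, as
-- points of 2^(ℕ×ℕ).

record E∞ : Set where
  field
    χ : ℕ → ℕ → Bool

  _∼_ : Rel ℕ 0ℓ
  i ∼ j = T (χ i j)

  field
    isEquivalence : IsEquivalence _∼_

  setoid : Setoid 0ℓ 0ℓ
  setoid = record { isEquivalence = isEquivalence }

  -- Infinitely many classes: no finite list of numbers meets every class.
  field
    infinite : ∀ (xs : List ℕ) → ∃[ m ] SetoidMembership._∉_ setoid m xs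

  class : ℕ → Pred ℕ 0ℓ
  class a x = x ∼ a

-- Equality of the relations themselves; the proofs in the record are ignored.
infix 4 _≈_
_≈_ : Rel E∞ 0ℓ
A ≈ B = ∀ i j → E∞.χ A i j ≡ E∞.χ B i j

E∞-setoid : Setoid 0ℓ 0ℓ
E∞-setoid = record
  { Carrier       = E∞
  ; _≈_           = _≈_
  ; isEquivalence = record
    { refl  = λ _ _ → refl
    ; sym   = λ p i j → sym (p i j)
    ; trans = λ p q i j → trans (p i j) (q i j)
    }
  }

-- Every A-class is the union of the B-classes of the elements of some set P.
infix 4 _≼_
_≼_ : E∞ → E∞ → Set₁
A ≼ B = ∀ a → Σ[ P ∈ Pred ℕ 0ℓ ]
  E∞.class A a ≐ ⋃ (Σ ℕ P) (λ b → E∞.class B (proj₁ b))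

≼⇔⇒ : ∀ A B → A ≼ B ⇔ (E∞._∼_ B ⇒ E∞._∼_ A)
≼⇔⇒ A B = mk⇔ to from
  where
  module A = IsEquivalence (E∞.isEquivalence A)
  module B = IsEquivalence (E∞.isEquivalence B)

  to : A ≼ B → E∞._∼_ B ⇒ E∞._∼_ A
  to A≼B {x} {y} x∼y with A≼B y
  ... | P , ⊆⋃ , ⋃⊆ with ⊆⋃ {y} A.refl
  ...   | b , y∼b = ⋃⊆ (b , B.trans x∼y y∼b)

  from : E∞._∼_ B ⇒ E∞._∼_ A → A ≼ B
  from B⇒A a = E∞.class A a
    , (λ {x} x∼a → (x , x∼a) , B.refl)
    , (λ { ((b , b∼a) , x∼b) → A.trans (B⇒A x∼b) b∼a })

record Efin : Set where
  field
    dom           : ℕ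
    χ             : Fin dom → Fin dom → Bool
    isEquivalence : IsEquivalence (λ i j → T (χ i j))

infix 4 _≈fin_
_≈fin_ : Rel Efin 0ℓ
s ≈fin t = Σ[ eq ∈ Efin.dom s ≡ Efin.dom t ]
  (∀ i j → Efin.χ s i j ≡ Efin.χ t (cast eq i) (cast eq j))

restrict : E∞ → ℕ → Efin
restrict A k = record
  { dom           = k
  ; χ             = λ i j → E∞.χ A (toℕ i) (toℕ j)
  ; isEquivalence = record
    { refl  = A.refl
    ; sym   = A.sym
    ; trans = A.trans
    }
  }
  where module A = IsEquivalence (E∞.isEquivalence A)

IsLeast : Pred ℕ 0ℓ → Pred ℕ 0ℓ
IsLeast P m = P m × (∀ k → P k → m ≤ k)

least : ∀ {P : Pred ℕ 0ℓ} → Decidable P → ∃ P → ∃ (IsLeast P)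
least {P} P? (n , Pn) = <-rec (λ n → P n → ∃ (IsLeast P)) step n Pn
  where
  step : ∀ n → (∀ {k} → k < n → P k → ∃ (IsLeast P)) → P n → ∃ (IsLeast P)
  step n rec Pn with anyUpTo? P? n
  ... | yes (k , k<n , Pk) = rec k<n Pk
  ... | no none = n , Pn , λ k Pk → ≮⇒≥ (λ k<n → none (k , k<n , Pk))

module _ (A : E∞) where
  open E∞ A
  private module A = IsEquivalence isEquivalence

  IsMinimum : Pred ℕ 0ℓ
  IsMinimum m = ∃[ a ] IsLeast (class a) m

  isMinimum? : Decidable IsMinimum
  isMinimum? m = map′ to from (allUpTo? (λ k → ¬? (T? (χ k m))) m)
    where
    to : (∀ {k} → k < m → ¬ k ∼ m) → IsMinimum m
    to f = m , A.refl , λ k k∼m → ≮⇒≥ (λ k<m → f k<m k∼m)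

    from : IsMinimum m → ∀ {k} → k < m → ¬ k ∼ m
    from (a , m∼a , m≤) {k} k<m k∼m = <⇒≱ k<m (m≤ k (A.trans k∼m m∼a))

  minimum-unbounded : ∀ n → ∃[ m ] n ≤ m × IsMinimum m
  minimum-unbounded n with infinite (upTo n)
  ... | a , a∉ with least (λ k → T? (χ k a)) (a , A.refl)
  ...   | m , m∼a , m≤ =
    m , ≮⇒≥ (λ m<n → a∉ (lose (∈-upTo⁺ m<n) (A.sym m∼a))) , a , m∼a , m≤

  leastMinimum≥ : ∀ n → ∃ (IsLeast (λ m → n ≤ m × IsMinimum m))
  leastMinimum≥ n = least (λ m → (n ≤? m) ×-dec isMinimum? m) (minimum-unbounded n)

  μ : ℕ → ℕ
  μ zero    = proj₁ (leastMinimum≥ 0)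
  μ (suc n) = proj₁ (leastMinimum≥ (suc (μ n)))

  -- The next three facts characterise μ as the increasing enumeration of
  -- the minima of the classes.

  μ-isMinimum : ∀ n → IsMinimum (μ n)
  μ-isMinimum zero    = proj₂ (proj₁ (proj₂ (leastMinimum≥ 0)))
  μ-isMinimum (suc n) = proj₂ (proj₁ (proj₂ (leastMinimum≥ (suc (μ n)))))

  μ-increasing : ∀ n → μ n < μ (suc n)
  μ-increasing n = proj₁ (proj₁ (proj₂ (leastMinimum≥ (suc (μ n)))))

  μ-surjective : ∀ {m} → IsMinimum m → ∃[ n ] μ n ≡ m
  μ-surjective {m} min = search m (n≤μn m)
    where
    n≤μn : ∀ n → n ≤ μ n
    n≤μn zero    = z≤n
    n≤μn (suc n) = ≤-trans (s≤s (n≤μn n)) (μ-increasing n)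

    search : ∀ n → m ≤ μ n → ∃[ k ] μ k ≡ m
    search zero m≤ =
      0 , ≤-antisym (proj₂ (proj₂ (leastMinimum≥ 0)) m (z≤n , min)) m≤
    search (suc n) m≤ with m ≤? μ n
    ... | yes m≤μn = search n m≤μn
    ... | no  m≰μn = suc n ,
      ≤-antisym (proj₂ (proj₂ (leastMinimum≥ (suc (μ n)))) m (≰⇒> m≰μn , min)) m≤

r : ℕ → E∞ → Efin
r n A = restrict A (μ A n)

tr : E∞ → E∞ → ℕ → Efin
tr A B n = restrict A (μ B n)

⟦_,_⟧ : Efin → E∞ → Pred E∞ (lsuc 0ℓ)
⟦ s , A ⟧ B = B ≼ A × (∃[ n ] s ≈fin r n B)

-- Predicates are compared up to ≐, so both generated families below are
-- closed under it explicitly.  Unions indexed by J : Set are arbitrary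
-- unions, since the ambient space X is itself in Set.

data GeneratedTopology {X I : Set} (S : I → Pred X 0ℓ) : Pred (Pred X 0ℓ) (lsuc 0ℓ) where
  subbasic : ∀ i → GeneratedTopology S (S i)
  whole    : GeneratedTopology S U
  inter    : ∀ {V W} → GeneratedTopology S V → GeneratedTopology S W →
             GeneratedTopology S (V ∩ W)
  union    : ∀ {J : Set} {V : J → Pred X 0ℓ} → (∀ j → GeneratedTopology S (V j)) →
             GeneratedTopology S (⋃ J V)
  resp     : ∀ {V W} → V ≐ W → GeneratedTopology S V → GeneratedTopology S W

data GeneratedσAlgebra {X : Set} (G : Pred (Pred X 0ℓ) (lsuc 0ℓ)) :
                       Pred (Pred X 0ℓ) (lsuc 0ℓ) where
  generator  : ∀ {V} → G V → GeneratedσAlgebra G V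
  complement : ∀ {V} → GeneratedσAlgebra G V → GeneratedσAlgebra G (∁ V)
  union      : ∀ {V : ℕ → Pred X 0ℓ} → (∀ n → GeneratedσAlgebra G (V n)) →
               GeneratedσAlgebra G (⋃ ℕ V)
  resp       : ∀ {V W} → V ≐ W → GeneratedσAlgebra G V → GeneratedσAlgebra G W

Cylinder : Efin → Pred E∞ 0ℓ
Cylinder s A = ∃[ n ] r n A ≈fin s

Open : Pred (Pred E∞ 0ℓ) (lsuc 0ℓ)
Open = GeneratedTopology Cylinder

Borel : Pred (Pred E∞ 0ℓ) (lsuc 0ℓ)
Borel = GeneratedσAlgebra Open

E∞-map : Set
E∞-map = E∞-setoid ⟶ₛ E∞-setoid

BorelMap : Pred E∞-map (lsuc 0ℓ)
BorelMap f = ∀ V → V ∈ Borel → (Func.to f ⊢ V) ∈ Borel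

RamseyConull : Pred (Pred E∞ 0ℓ) (lsuc 0ℓ)
RamseyConull C = ∀ s A → Satisfiable ⟦ s , A ⟧ →
  ∃[ B ] B ∈ ⟦ s , A ⟧ × ⟦ s , B ⟧ ⊆ C

TracialOn : E∞-map → Pred E∞ 0ℓ → Set₁
TracialOn f X = ∀ B → B ∈ X → ∃[ n₀ ] ∀ n → n₀ ≤ n →
  ∀ A A′ → A ≼ B → A′ ≼ B →
  (∃[ k ] ∃[ s ] s ≈fin r k A × s ≈fin r k A′ × Efin.dom s ≡ μ B n) →
  tr (Func.to f A) B n ≈fin tr (Func.to f A′) B n

{-# OPTIONS --safe #-}
module Submission where

-- A relation is replaced by the map sending x to the minimum of its class; then C ≤ A reads
-- C ∘ A = C.  Fusion shows that a hereditary dense property of basic sets [t, B] can be made to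
-- hold for all t at once.  With the Carlson–Simpson theorem as pigeonhole principle,
-- combinatorial forcing makes Ellentuck-open sets Ramsey, and fusion reduces countable unions
-- of Ramsey sets to open ones, so Borel sets are Ramsey.  Fusing once more, below any A there
-- is B such that for every minimum k of B and every t with domain k, the restriction of f to
-- {0,…,k-1} is constant on [t, B]; this passes to all C ≤ B, whose minima are minima of B.
--
-- For Carlson–Simpson, call a set of words large if it meets every subspace.  Large sets are
-- partition regular and syndetic, so by Hales–Jewett a large set X has a left variable word v
-- and a word u ∈ X such that u v(b) z ∈ X for all letters b and a large set of z; iterating
-- builds a subspace inside X.

open import Defs
open import Axiom.ExcludedMiddle using (ExcludedMiddle)
open import Data.Bool.Base using (true; false; T)
open import Data.Bool.Properties using (T?)
open import Data.Fin.Base using (Fin; toℕ; fromℕ<; cast)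
open import Data.Fin.Properties using (toℕ-fromℕ<; toℕ<n; toℕ≤pred[n]; toℕ-cast; cast-trans; cast-is-id)
open import Data.List.Base using (List; []; _∷_; [_]; _++_; map; length; upTo; applyUpTo; allFin;
  cartesianProduct; cartesianProductWith; initLast; _∷ʳ′_)
open import Data.List.Extrema.Nat using (max; xs≤max)
open import Data.List.Membership.Propositional using (_∈_)
open import Data.List.Membership.Propositional.Properties using (∈-cartesianProductWith⁺;
  ∈-cartesianProduct⁺; ∈-++⁺ˡ; ∈-++⁺ʳ; ∈-map⁺; ∈-upTo⁺; ∈-allFin)
open import Data.List.Properties using (++-assoc; ++-identityʳ; length-++; length-map; map-++; map-∘;
  map-cong; ∷-injectiveˡ; ∷-injectiveʳ; length-applyUpTo)
open import Data.List.Relation.Unary.All using (All; []; _∷_)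
import Data.List.Relation.Unary.All as All
import Data.List.Relation.Unary.All.Properties as Allₚ
open import Data.List.Relation.Unary.Any using (here; there)
open import Data.Maybe.Base using (Maybe; just; nothing; maybe′; fromMaybe)
open import Data.Nat.Base using (ℕ; zero; suc; _≤_; _<_; _+_; _∸_; _⊔_; z≤n; s≤s; z<s)
open import Data.Nat.Properties
open import Data.Product using (Σ; Σ-syntax; ∃; ∃-syntax; _×_; _,_; proj₁; proj₂)
open import Data.Sum.Base using (_⊎_; inj₁; inj₂)
open import Data.Unit.Base using (⊤; tt)
open import Function.Base using (_∘_; id; case_of_)
open import Function.Bundles using (Func; Equivalence)
open import Level using (0ℓ)
open import Relation.Binary.Core using (_⇒_)
open import Relation.Binary.Definitions using (_Respects_; tri<; tri≈; tri>)
open import Relation.Binary.PropositionalEquality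
  using (_≡_; refl; sym; trans; cong; cong₂; subst; subst₂; module ≡-Reasoning)
open import Relation.Binary.Structures using (IsEquivalence)
open import Relation.Nullary using (¬_; yes; no; contradiction)
open import Relation.Nullary.Decidable using (decidable-stable; ⌊_⌋; toWitness; fromWitness; _×-dec_)
open import Relation.Unary using (Pred; _⊆_)

-- Finite lists.

tuples : {A : Set} → List A → ℕ → List (List A)
tuples xs zero    = [] ∷ []
tuples xs (suc n) = cartesianProductWith _∷_ xs (tuples xs n)

∈-tuples : {A : Set} {xs : List A} → ∀ n w → length w ≡ n → All (_∈ xs) w → w ∈ tuples xs n
∈-tuples zero    []      eq []         = here refl
∈-tuples (suc n) (a ∷ w) eq (a∈ ∷ w∈) =
  ∈-cartesianProductWith⁺ _∷_ a∈ (∈-tuples n w (suc-injective eq) w∈)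

-- Lets a list of colours act as a single colour that can be read pointwise.
map-injective-∈ : {A B : Set} {f g : A → B} {x : A} → ∀ xs →
  map f xs ≡ map g xs → x ∈ xs → f x ≡ g x
map-injective-∈ (y ∷ xs) eq (here refl) = ∷-injectiveˡ eq
map-injective-∈ (y ∷ xs) eq (there x∈)  = map-injective-∈ xs (∷-injectiveʳ eq) x∈

remove : {A : Set} {x : A} {xs : List A} → x ∈ xs →
  ∃[ ys ] suc (length ys) ≡ length xs × (∀ {y} → y ∈ xs → y ≡ x ⊎ y ∈ ys)
remove {xs = _ ∷ xs} (here refl) = xs , refl , λ { (here refl) → inj₁ refl ; (there y∈) → inj₂ y∈ }
remove {xs = z ∷ xs} (there x∈) with remove x∈
... | ys , eq , split = z ∷ ys , cong suc eq , λ
  { (here refl) → inj₂ (here refl)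
  ; (there y∈)  → case split y∈ of λ { (inj₁ e) → inj₁ e ; (inj₂ y∈ys) → inj₂ (there y∈ys) } }

-- The Hales-Jewett theorem.

module Words (L : Set) (letters : List L) (complete : ∀ a → a ∈ letters) where

  Word VWord : Set
  Word  = List L
  VWord = List (Maybe L)

  -- nothing is the variable.
  inst : L → VWord → Word
  inst a = map (fromMaybe a)

  const : Word → VWord
  const = map just

  inst-const : ∀ a w → inst a (const w) ≡ w
  inst-const a []      = refl
  inst-const a (b ∷ w) = cong (b ∷_) (inst-const a w)

  inst-++ : ∀ a g h → inst a (g ++ h) ≡ inst a g ++ inst a h
  inst-++ a = map-++ (fromMaybe a)

  inst-const-++ : ∀ a w h → inst a (const w ++ h) ≡ w ++ inst a h
  inst-const-++ a w h = trans (inst-++ a (const w) h) (cong (_++ inst a h) (inst-const a w))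

  inst-++-const : ∀ a h w → inst a (h ++ const w) ≡ inst a h ++ w
  inst-++-const a h w = trans (inst-++ a h (const w)) (cong (inst a h ++_) (inst-const a w))

  length-inst : ∀ a h → length (inst a h) ≡ length h
  length-inst a = length-map (fromMaybe a)

  words : ℕ → List Word
  words = tuples letters

  ∈-words : ∀ {n} w → length w ≡ n → w ∈ words n
  ∈-words w eq = ∈-tuples _ w eq (All.tabulate λ {a} _ → complete a)

  -- Turns a line into a left variable word behind constants: the split is at the first variable.
  splitAtVariable : ∀ {h} → nothing ∈ h → ∃[ u ] ∃[ v ] h ≡ const u ++ nothing ∷ v
  splitAtVariable (here refl) = [] , _ , refl
  splitAtVariable {nothing ∷ h} (there _) = [] , h , refl
  splitAtVariable {just a ∷ h} (there n∈) with splitAtVariable n∈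
  ... | u , v , refl = a ∷ u , v , refl

  Coloured : {K : Set} → List L → (Word → K) → VWord → K → Set
  Coloured ls c h k = ∀ {a} → a ∈ ls → c (inst a h) ≡ k

  -- A line may use constants from all of `L` but is tested only at the letters of `ls`, so the
  -- induction on `ls` stays inside one type of words.
  record Mono {K : Set} (ls : List L) (M : ℕ) (c : Word → K) : Set where
    constructor mono
    field
      line     : VWord
      len      : length line ≡ M
      ∋variable : nothing ∈ line
      colour   : K
      coloured : Coloured ls c line colour

  -- The colour type is bound inside because the induction applies the smaller case to lists of
  -- colours.
  HalesJewett : List L → Set₁
  HalesJewett ls = ∀ {K : Set} (ks : List K) → ∃[ M ] ∀ (c : Word → K) → (∀ w → c w ∈ ks) → Mono ls M c

  -- Colour focusing: all lines found so far agree at a₀ with one word, and their colours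
  -- on the remaining letters are distinct; once the colours are used up, that word shares its
  -- colour with one of the lines.
  module Focusing (a₀ a₁ : L) (ls : List L) (hj : HalesJewett (a₁ ∷ ls)) {K : Set} (ks : List K) where

    record Focused (m M : ℕ) (c : Word → K) : Set where
      constructor focused
      field
        focus   : Word
        len     : length focus ≡ M
        unused  : List K
        few     : length unused + m ≤ length ks
        used    : ∀ {k} → k ∈ ks → k ∈ unused ⊎
          (∃[ h ] length h ≡ M × nothing ∈ h × inst a₀ h ≡ focus × Coloured (a₁ ∷ ls) c h k)

    mono-prefix : ∀ {M c N} w → length w ≡ N → Mono (a₀ ∷ a₁ ∷ ls) M (c ∘ (w ++_)) →
      Mono {K} (a₀ ∷ a₁ ∷ ls) (N + M) c
    mono-prefix {c = c} w eq (mono h len n∈ k col) = mono (const w ++ h)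
      (trans (length-++ (const w)) (cong₂ _+_ (trans (length-map just w) eq) len))
      (∈-++⁺ʳ (const w) n∈) k
      (λ {a} a∈ → trans (cong c (inst-const-++ a w h)) (col a∈))

    focusing : ∀ m → ∃[ M ] ∀ c → (∀ w → c w ∈ ks) → Mono (a₀ ∷ a₁ ∷ ls) M c ⊎ Focused m M c
    focusing zero = 0 , λ c c∈ →
      inj₂ (focused [] refl ks (≤-reflexive (+-identityʳ _)) inj₁)
    focusing (suc m) with focusing m
    -- A prefix is coloured by the list of colours of all its extensions by words of length M. On a
    -- line constant for this colouring, the letters of `a₁ ∷ ls` are interchangeable.
    ... | M , focM with hj (tuples ks (length (words M)))
    ...   | N , monoN = N + M , step
      where
      step : ∀ c → (∀ w → c w ∈ ks) → Mono (a₀ ∷ a₁ ∷ ls) (N + M) c ⊎ Focused (suc m) (N + M) c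
      step c c∈ with monoN (λ g → map (λ w → c (g ++ w)) (words M))
                   (λ g → ∈-tuples _ _ (length-map _ (words M)) (Allₚ.map⁺ (All.tabulate λ {w} _ → c∈ (g ++ w))))
      ... | mono g lenG g∋ K* colG with focM (λ w → c (inst a₁ g ++ w)) (λ w → c∈ (inst a₁ g ++ w))
      ...   | inj₁ mn = inj₁ (mono-prefix (inst a₁ g) (trans (length-inst a₁ g) lenG) mn)
      ...   | inj₂ (focused f lenF un few used) = result
        where
        same : ∀ {a} → a ∈ a₁ ∷ ls → ∀ w → length w ≡ M → c (inst a g ++ w) ≡ c (inst a₁ g ++ w)
        same a∈ w eq = map-injective-∈ (words M) (trans (colG a∈) (sym (colG (here refl)))) (∈-words w eq)

        k* = c (inst a₁ g ++ f)

        result : Mono (a₀ ∷ a₁ ∷ ls) (N + M) c ⊎ Focused (suc m) (N + M) c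
        result with used (c∈ (inst a₁ g ++ f))
        -- The focus is the instance at `a₀` of a line that already has its colour at the other
        -- letters, so this line is monochromatic at `a₀` too.
        ... | inj₂ (h , lenH , h∋ , h≡f , colH) =
          inj₁ (mono-prefix (inst a₁ g) (trans (length-inst a₁ g) lenG)
            (mono h lenH h∋ k* λ { (here refl) → cong (λ w → c (inst a₁ g ++ w)) h≡f ; (there a∈) → colH a∈ }))
        ... | inj₁ k*∈ with remove k*∈
        -- The new line `g ++ const f` takes the colour `k*`, and each old line h continues as
        -- `g ++ h`; at `a₀` they all give the new focus.
        ...   | un′ , lenUn , split = inj₂ (focused (inst a₀ g ++ f)
          (trans (length-++ (inst a₀ g)) (cong₂ _+_ (trans (length-inst a₀ g) lenG) lenF))
          un′ (subst (_≤ length ks) (trans (cong (_+ m) (sym lenUn)) (sym (+-suc (length un′) m))) few)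
          λ k∈ → case used k∈ of λ
            { (inj₁ k∈un) → case split k∈un of λ
                { (inj₁ refl) → inj₂ (g ++ const f
                    , trans (length-++ g) (cong₂ _+_ lenG (trans (length-map just f) lenF))
                    , ∈-++⁺ˡ g∋
                    , inst-++-const a₀ g f
                    , λ {a} a∈ → trans (cong c (inst-++-const a g f)) (same a∈ f lenF))
                ; (inj₂ k∈un′) → inj₁ k∈un′ }
            ; (inj₂ (h , lenH , h∋ , h≡f , colH)) → inj₂ (g ++ h
                , trans (length-++ g) (cong₂ _+_ lenG lenH)
                , ∈-++⁺ˡ g∋
                , trans (inst-++ a₀ g h) (cong (inst a₀ g ++_) h≡f)
                , λ {a} a∈ → trans (cong c (inst-++ a g h))
                    (trans (same a∈ (inst a h) (trans (length-inst a h) lenH)) (colH a∈))) })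

  halesJewett : ∀ ls → HalesJewett ls
  halesJewett []       ks = 1 , λ c _ → mono (nothing ∷ []) refl (here refl) (c []) λ ()
  halesJewett (a ∷ []) ks = 1 , λ c _ → mono (nothing ∷ []) refl (here refl) (c (a ∷ [])) λ { (here refl) → refl }
  -- With more rounds than entries of `ks` the bound `few` fails, so the monochromatic case remains.
  halesJewett (a₀ ∷ a₁ ∷ ls) ks with Focusing.focusing a₀ a₁ ls (halesJewett (a₁ ∷ ls)) ks (suc (length ks))
  ... | M , foc = M , λ c c∈ → case foc c c∈ of λ
    { (inj₁ mn) → mn
    ; (inj₂ (Focusing.focused _ _ un few _)) → contradiction few (<⇒≱ (m≤n+m _ (length un))) }

module Classical (em : ∀ {ℓ} → ExcludedMiddle ℓ) where

  ¬∀⇒∃¬ : ∀ {a b} {A : Set a} {P : A → Set b} → ¬ (∀ x → P x) → ∃[ x ] ¬ P x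
  ¬∀⇒∃¬ {P = P} ¬∀ with em {P = ∃[ x ] ¬ P x}
  ... | yes ∃¬ = ∃¬
  ... | no ¬∃¬ = contradiction (λ x → decidable-stable em λ ¬Px → ¬∃¬ (x , ¬Px)) ¬∀

  ¬∃⇒∀¬ : ∀ {a b} {A : Set a} {P : A → Set b} → ¬ (∃[ x ] P x) → ∀ x → ¬ P x
  ¬∃⇒∀¬ ¬∃ x Px = ¬∃ (x , Px)

-- The Carlson-Simpson theorem.

module Substitutions (em : ∀ {ℓ} → ExcludedMiddle ℓ)
  (L : Set) (letters : List L) (complete : ∀ a → a ∈ letters) (a⋆ : L) where
  open Classical em
  open Words L letters complete

  -- φ enumerates the words w₀ v₁(a₁) … vₙ(aₙ) of a Carlson–Simpson subspace: w₀ = φ [], and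
  -- vₙ₊₁ is the left variable word consisting of the variable followed by block n.
  record IsSub (φ : Word → Word) : Set where
    constructor isSub
    field
      block : ℕ → VWord
      snoc  : ∀ w a → φ (w ++ [ a ]) ≡ φ w ++ a ∷ inst a (block (length w))

  open IsSub

  extend : (ℕ → VWord) → ℕ → Word → Word
  extend B n []      = []
  extend B n (a ∷ w) = a ∷ inst a (B n) ++ extend B (suc n) w

  extend-snoc : ∀ B n w a → extend B n (w ++ [ a ]) ≡ extend B n w ++ a ∷ inst a (B (n + length w))
  extend-snoc B n [] a = cong (a ∷_) (trans (++-identityʳ _) (cong (inst a ∘ B) (sym (+-identityʳ n))))
  extend-snoc B n (b ∷ w) a = cong (b ∷_) (begin
    inst b (B n) ++ extend B (suc n) (w ++ [ a ])   ≡⟨ cong (inst b (B n) ++_) (extend-snoc B (suc n) w a) ⟩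
    inst b (B n) ++ extend B (suc n) w ++ a ∷ inst a (B (suc n + length w))
      ≡⟨ cong (λ m → inst b (B n) ++ extend B (suc n) w ++ a ∷ inst a (B m)) (sym (+-suc n (length w))) ⟩
    inst b (B n) ++ extend B (suc n) w ++ a ∷ inst a (B (n + suc (length w))) ≡⟨ sym (++-assoc (inst b (B n)) _ _) ⟩
    (inst b (B n) ++ extend B (suc n) w) ++ a ∷ inst a (B (n + suc (length w))) ∎)
    where open ≡-Reasoning

  extend-isSub : ∀ B n → IsSub (extend B n)
  extend-isSub B n = isSub (λ m → B (n + m)) (extend-snoc B n)

  -- By moving the letters of z to y one at a time. What z contributes depends on y only through its
  -- length.
  sub-++ : ∀ {φ} (s : IsSub φ) y z → φ (y ++ z) ≡ φ y ++ extend (block s) (length y) z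
  sub-++ {φ} s y [] = trans (cong φ (++-identityʳ y)) (sym (++-identityʳ (φ y)))
  sub-++ {φ} s y (a ∷ z) = begin
    φ (y ++ a ∷ z)                                      ≡⟨ cong φ (sym (++-assoc y [ a ] z)) ⟩
    φ ((y ++ [ a ]) ++ z)                               ≡⟨ sub-++ s (y ++ [ a ]) z ⟩
    φ (y ++ [ a ]) ++ extend (block s) (length (y ++ [ a ])) z
      ≡⟨ cong₂ (λ u n → u ++ extend (block s) n z) (snoc s y a) (trans (length-++ y) (+-comm (length y) 1)) ⟩
    (φ y ++ a ∷ inst a (block s (length y))) ++ extend (block s) (suc (length y)) z ≡⟨ ++-assoc (φ y) _ _ ⟩
    φ y ++ extend (block s) (length y) (a ∷ z)              ∎
    where open ≡-Reasoning

  -- The action of `extend` on variable words, arranged to commute with instantiation: a block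
  -- behind a constant letter is filled with that letter.
  extendV : (ℕ → VWord) → ℕ → VWord → VWord
  extendV B n []            = []
  extendV B n (just b ∷ h)  = just b ∷ const (inst b (B n)) ++ extendV B (suc n) h
  extendV B n (nothing ∷ h) = nothing ∷ B n ++ extendV B (suc n) h

  extend-inst : ∀ B n a h → extend B n (inst a h) ≡ inst a (extendV B n h)
  extend-inst B n a [] = refl
  extend-inst B n a (just b ∷ h) = cong (b ∷_)
    (trans (cong (inst b (B n) ++_) (extend-inst B (suc n) a h)) (sym (inst-const-++ a (inst b (B n)) _)))
  extend-inst B n a (nothing ∷ h) = cong (a ∷_)
    (trans (cong (inst a (B n) ++_) (extend-inst B (suc n) a h)) (sym (inst-++ a (B n) _)))

  size : ∀ {φ} → IsSub φ → ℕ → ℕ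
  size {φ} s zero    = length (φ [])
  size s (suc n) = size s n + suc (length (block s n))

  -- The length of a block does not depend on the letter filled in. Needed for compositions, whose
  -- blocks may depend on a word only through its length.
  length-sub : ∀ {φ} (s : IsSub φ) n w → length w ≡ n → length (φ w) ≡ size s n
  length-sub s zero [] eq = refl
  length-sub {φ} s (suc n) w eq with initLast w
  ... | w′ ∷ʳ′ a = begin
    length (φ (w′ ++ [ a ]))                                     ≡⟨ cong length (snoc s w′ a) ⟩
    length (φ w′ ++ a ∷ inst a (block s (length w′)))            ≡⟨ length-++ (φ w′) ⟩
    length (φ w′) + suc (length (inst a (block s (length w′))))
      ≡⟨ cong₂ (λ l m → l + suc m) (length-sub s n w′ eq′)
           (trans (length-inst a (block s (length w′))) (cong (length ∘ block s) eq′)) ⟩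
    size s n + suc (length (block s n)) ∎
    where
    open ≡-Reasoning
    eq′ : length w′ ≡ n
    eq′ = suc-injective (trans (trans (+-comm 1 (length w′)) (sym (length-++ w′))) eq)

  id-isSub : IsSub id
  id-isSub = isSub (λ _ → []) λ _ _ → refl

  -- The image of the left variable word `nothing ∷ h` without its leading variable, which blocks
  -- omit as well.
  extendLeft : (ℕ → VWord) → ℕ → VWord → VWord
  extendLeft B n h = B n ++ extendV B (suc n) h

  extend-left : ∀ B n a h → extend B n (a ∷ inst a h) ≡ a ∷ inst a (extendLeft B n h)
  extend-left B n a h = cong (a ∷_)
    (trans (cong (inst a (B n) ++_) (extend-inst B (suc n) a h)) (sym (inst-++ a (B n) _)))

  sub-left : ∀ {φ} (s : IsSub φ) y a h →
    φ (y ++ a ∷ inst a h) ≡ φ y ++ a ∷ inst a (extendLeft (block s) (length y) h)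
  sub-left s y a h = trans (sub-++ s y _) (cong (_++_ _) (extend-left (block s) (length y) a h))

  ∘-isSub : ∀ {φ ψ} → IsSub φ → IsSub ψ → IsSub (φ ∘ ψ)
  ∘-isSub {φ} {ψ} s t = isSub (λ n → extendLeft (block s) (size t n) (block t n)) λ w a → begin
    φ (ψ (w ++ [ a ]))                                      ≡⟨ cong φ (snoc t w a) ⟩
    φ (ψ w ++ a ∷ inst a (block t (length w)))              ≡⟨ sub-left s (ψ w) a _ ⟩
    φ (ψ w) ++ a ∷ inst a (extendLeft (block s) (length (ψ w)) (block t (length w)))
      ≡⟨ cong (λ n → φ (ψ w) ++ a ∷ inst a (extendLeft (block s) n (block t (length w)))) (length-sub t _ w refl) ⟩
    φ (ψ w) ++ a ∷ inst a (extendLeft (block s) (size t (length w)) (block t (length w))) ∎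
    where open ≡-Reasoning

  record Large (X : Word → Set) : Set where
    constructor large
    field
      meets : ∀ φ → IsSub φ → ∃[ u ] X (φ u)

  open Large

  large-∘ : ∀ {X φ} → Large X → IsSub φ → Large (X ∘ φ)
  large-∘ lX s = large λ ψ t → meets lX _ (∘-isSub s t)

  large-mono : ∀ {X Y} → (∀ u → X u → Y u) → Large X → Large Y
  large-mono X⊆Y lX = large λ φ s → let u , x = meets lX φ s in u , X⊆Y _ x

  avoided : ∀ {X} → ¬ Large X → ∃[ φ ] IsSub φ × (∀ u → ¬ X (φ u))
  avoided ¬lX with ¬∀⇒∃¬ (¬lX ∘ large)
  ... | φ , ¬φ with ¬∀⇒∃¬ ¬φ
  ...   | s , ¬u = φ , s , ¬∃⇒∀¬ ¬u

  -- A set that is not large is avoided on some subspace, where the remaining sets still cover.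
  -- Hence the largeness obtained is relative to the subspace reached.
  partition : ∀ {I : Set} (is : List I) {X : Word → Set} (Y : I → Word → Set) → Large X →
    (∀ u → X u → ∃[ i ] i ∈ is × Y i u) → ∃[ i ] ∃[ φ ] IsSub φ × Large (Y i ∘ φ)
  partition [] Y lX cover with meets lX id id-isSub
  ... | u , x with cover u x
  ...   | _ , () , _
  partition (i ∷ is) {X} Y lX cover with em {P = Large (Y i)}
  ... | yes lY = i , id , id-isSub , lY
  ... | no ¬lY with avoided ¬lY
  ...   | φ , s , avoid with partition is (λ j → Y j ∘ φ) (large-∘ lX s) cover′
    where
    cover′ : ∀ u → X (φ u) → ∃[ j ] j ∈ is × Y j (φ u)
    cover′ u x with cover (φ u) x
    ... | _ , here refl , y = contradiction y (avoid u)
    ... | j , there j∈ , y  = j , j∈ , y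
  ...     | j , ψ , t , lYψ = j , φ ∘ ψ , ∘-isSub s t , lYψ

  -- If X is not syndetic, a subspace avoiding X is built by choosing each block to avoid X
  -- after every prefix of the length reached.
  module Avoiding {X : Word → Set} (f : ℕ → Word)
    (avoid : ∀ n w → length w ≡ n → ¬ X (w ++ f n)) where

    ψ : ℕ → Word → Word
    ψ n []      = []
    ψ n (a ∷ w) = a ∷ f (suc n) ++ ψ (suc n + length (f (suc n))) w

    next : ℕ → ℕ
    next n = suc n + length (f (suc n))

    blocks : ℕ → ℕ → VWord
    blocks n zero    = const (f (suc n))
    blocks n (suc m) = blocks (next n) m

    ψ-snoc : ∀ n w a → ψ n (w ++ [ a ]) ≡ ψ n w ++ a ∷ inst a (blocks n (length w))
    ψ-snoc n [] a = cong (a ∷_) (trans (++-identityʳ _) (sym (inst-const a _)))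
    ψ-snoc n (b ∷ w) a = cong (b ∷_)
      (trans (cong (f (suc n) ++_) (ψ-snoc (next n) w a)) (sym (++-assoc (f (suc n)) _ _)))

    ψ-avoids : ∀ n p w → length p ≡ n → ¬ X p → ¬ X (p ++ ψ n w)
    ψ-avoids n p [] eq ¬x = ¬x ∘ subst X (++-identityʳ p)
    ψ-avoids n p (a ∷ w) eq ¬x = ψ-avoids (next n) ((p ++ [ a ]) ++ f (suc n)) w
        (trans (length-++ (p ++ [ a ])) (cong (_+ _) eq′)) (avoid (suc n) (p ++ [ a ]) eq′)
      ∘ subst X (trans (cong (p ++_) (sym (++-assoc [ a ] (f (suc n)) _)))
         (trans (sym (++-assoc p (a ∷ f (suc n)) _))
          (cong (_++ ψ (next n) w) (sym (++-assoc p [ a ] (f (suc n)))))))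
      where
      eq′ : length (p ++ [ a ]) ≡ suc n
      eq′ = trans (length-++ p) (trans (+-comm (length p) 1) (cong suc eq))

    ¬large : ¬ Large X
    ¬large lX with meets lX (λ w → f 0 ++ ψ (length (f 0)) w)
      (isSub (blocks (length (f 0))) λ w a →
        trans (cong (f 0 ++_) (ψ-snoc (length (f 0)) w a)) (sym (++-assoc (f 0) _ _)))
    ... | w , x = ψ-avoids (length (f 0)) (f 0) w refl (avoid 0 [] refl) x

  syndetic : ∀ {X} → Large X → ∃[ n ] ∀ u → ∃[ w ] length w ≡ n × X (w ++ u)
  syndetic {X} lX with em {P = ∃[ n ] ∀ u → ∃[ w ] length w ≡ n × X (w ++ u)}
  ... | yes syn = syn
  ... | no ¬syn = contradiction lX
    (Avoiding.¬large (λ n → proj₁ (¬∀⇒∃¬ (¬∃⇒∀¬ ¬syn n)))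
       (λ n w eq x → proj₂ (¬∀⇒∃¬ (¬∃⇒∀¬ ¬syn n)) (w , eq , x)))

  -- All letters b are required at once, so a subspace of this set, carried over by φ and put behind
  -- u and its first left variable word, stays in X.
  Shifted : (Word → Set) → Word → VWord → (Word → Word) → Word → Set
  Shifted X u v φ z = ∀ b → X (u ++ b ∷ inst b v ++ φ z)

  record Step (X : Word → Set) : Set where
    constructor step
    field
      u    : Word
      v    : VWord
      φ    : Word → Word
      φ-isSub : IsSub φ
      shifted-large : Large (Shifted X u v φ)

  -- Syndeticity colours the words h, for given z, by prefixes p with p h z ∈ X; Hales–Jewett
  -- gives a line of constant p, one of finitely many, so one of them serves a large set of z.
  largeStep : ∀ {X} → Large X → Step X
  largeStep {X} lX with syndetic lX
  ... | N , pre with halesJewett letters (words N)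
  ...   | M , hj with partition (cartesianProduct (words N) (tuples (nothing ∷ map just letters) M)) {λ _ → ⊤}
                    (λ (p , h) z → nothing ∈ h × (∀ b → X (p ++ inst b h ++ z))) (large λ _ _ → [] , tt) cover
    where
    cover : ∀ z → ⊤ → ∃[ i ] i ∈ cartesianProduct (words N) (tuples (nothing ∷ map just letters) M) ×
      nothing ∈ proj₂ i × (∀ b → X (proj₁ i ++ inst b (proj₂ i) ++ z))
    cover z _ with hj (λ w → proj₁ (pre (w ++ z))) (λ w → ∈-words _ (proj₁ (proj₂ (pre (w ++ z)))))
    ... | mono h len n∈ p col = (p , h)
      , ∈-cartesianProduct⁺
          p∈
          (∈-tuples M h len (All.tabulate λ { {nothing} _ → here refl ; {just a} _ → there (∈-map⁺ just (complete a)) }))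
      , n∈
      , X-line
      where
      X-line : ∀ b → X (p ++ inst b h ++ z)
      X-line b = subst (λ q → X (q ++ inst b h ++ z)) (col (complete b)) (proj₂ (proj₂ (pre (inst b h ++ z))))
      p∈ : p ∈ words N
      -- The letter `a⋆` makes p the colour of an actual instance, hence a word of length N.
      p∈ = subst (_∈ words N) (col (complete a⋆)) (∈-words _ (proj₁ (proj₂ (pre (inst a⋆ h ++ z)))))
  -- One point of the large set shows that h contains the variable; the constants before its first
  -- occurrence are moved to p.
  ...     | (p , h) , φ , s , lY with meets lY id id-isSub
  ...       | _ , n∈ , _ with splitAtVariable n∈
  ...         | u , v , refl = step (p ++ u) v φ s (large-mono {λ z → _ × ∀ b → X (p ++ inst b _ ++ φ z)} (λ z (_ , x) b →
    subst X (trans (cong (λ y → p ++ y ++ φ z) (inst-const-++ b u (nothing ∷ v)))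
      (trans (cong (p ++_) (++-assoc u _ (φ z))) (sym (++-assoc p u _)))) (x b)) lY)

  -- Parametric in the choice of steps because the iteration runs twice: with `largeStep`, to find a
  -- step that starts in the set, and then with such steps, to stay inside it.
  module Iterate (stp : ∀ {X} → Large X → Step X) where

    ψ : ∀ {X} → Large X → Word → Word
    ψ lX [] = Step.u (stp lX)
    ψ lX (a ∷ w) = let step u v φ _ lY = stp lX in u ++ a ∷ inst a v ++ φ (ψ lY w)

    sizeψ : ∀ {X} → Large X → ℕ → ℕ
    sizeψ lX zero = length (Step.u (stp lX))
    sizeψ lX (suc n) = let step u v φ s lY = stp lX in
      length u + suc (length v + size s (sizeψ lY n))

    length-ψ : ∀ {X} (lX : Large X) w → length (ψ lX w) ≡ sizeψ lX (length w)
    length-ψ lX [] = refl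
    length-ψ lX (a ∷ w) = let step u v φ s lY = stp lX in
      trans (length-++ u) (cong (λ n → length u + suc n)
        (trans (length-++ (inst a v) {φ (ψ lY w)}) (cong₂ _+_ (length-inst a v)
          (length-sub s (sizeψ lY (length w)) _ (length-ψ lY w)))))

    blocks : ∀ {X} → Large X → ℕ → VWord
    blocks lX zero = let step u v φ _ lY = stp lX in v ++ const (φ (ψ lY []))
    blocks lX (suc n) = let step u v φ s lY = stp lX in extendLeft (block s) (sizeψ lY n) (blocks lY n)

    ψ-snoc : ∀ {X} (lX : Large X) w a → ψ lX (w ++ [ a ]) ≡ ψ lX w ++ a ∷ inst a (blocks lX (length w))
    ψ-snoc lX [] a = let step u v φ _ lY = stp lX in
      cong (λ z → u ++ a ∷ z) (sym (inst-++-const a v (φ (ψ lY []))))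
    ψ-snoc lX (b ∷ w) a = let step u v φ s lY = stp lX in
      begin
      u ++ (b ∷ inst b v) ++ φ (ψ lY (w ++ [ a ]))
        ≡⟨ cong (λ z → u ++ (b ∷ inst b v) ++ z) (begin
          φ (ψ lY (w ++ [ a ])) ≡⟨ cong φ (ψ-snoc lY w a) ⟩
          φ (ψ lY w ++ a ∷ inst a (blocks lY (length w))) ≡⟨ sub-left s (ψ lY w) a _ ⟩
          φ (ψ lY w) ++ a ∷ inst a (extendLeft (block s) (length (ψ lY w)) (blocks lY (length w)))
            ≡⟨ cong (λ n → φ (ψ lY w) ++ a ∷ inst a (extendLeft (block s) n (blocks lY (length w)))) (length-ψ lY w) ⟩
          φ (ψ lY w) ++ a ∷ inst a (blocks lX (suc (length w))) ∎) ⟩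
      u ++ (b ∷ inst b v) ++ φ (ψ lY w) ++ a ∷ inst a (blocks lX (suc (length w)))
        ≡⟨ cong (u ++_) (sym (++-assoc (b ∷ inst b v) (φ (ψ lY w)) _)) ⟩
      u ++ ((b ∷ inst b v) ++ φ (ψ lY w)) ++ a ∷ inst a (blocks lX (suc (length w)))
        ≡⟨ sym (++-assoc u _ _) ⟩
      (u ++ (b ∷ inst b v) ++ φ (ψ lY w)) ++ a ∷ inst a (blocks lX (suc (length w))) ∎
      where open ≡-Reasoning

    ψ-isSub : ∀ {X} (lX : Large X) → IsSub (ψ lX)
    ψ-isSub lX = isSub (blocks lX) (ψ-snoc lX)

    ψ-∈ : (∀ {X} (lX : Large X) → X (Step.u (stp lX))) → ∀ {X} (lX : Large X) w → X (ψ lX w)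
    ψ-∈ u∈ lX []      = u∈ lX
    -- Membership in `Shifted` at the letter a is by definition membership of `ψ lX (a ∷ w)` in X.
    ψ-∈ u∈ lX (a ∷ w) = ψ-∈ u∈ (Step.shifted-large (stp lX)) w a

    -- Collapses the steps taken along w into a single one starting at `ψ lX w`: the inner large set
    -- concerns `Shifted`, which is instantiated at the letter a read.
    stepAt : ∀ {X} (lX : Large X) w → ∃[ v ] ∃[ φ ] IsSub φ × Large (Shifted X (ψ lX w) v φ)
    stepAt lX [] = let step u v φ s lY = stp lX in v , φ , s , lY
    stepAt {X} lX (a ∷ w) with stp lX
    ... | step u v φ s lY with stepAt lY w
    ...   | v′ , φ′ , s′ , lZ =
      extendLeft (block s) n v′ , extend (block s) m ∘ φ′ , ∘-isSub (extend-isSub (block s) m) s′ ,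
      large-mono (λ z Z b → subst X (regroup b z) (Z b a)) lZ
      where
      open ≡-Reasoning
      n = length (ψ lY w)
      -- The length of `ψ lY w ++ b ∷ inst b v′`, hence the block at which φ resumes on `φ′ z`.
      m = n + suc (length v′)
      regroup : ∀ b z → u ++ a ∷ inst a v ++ φ (ψ lY w ++ b ∷ inst b v′ ++ φ′ z) ≡
        (u ++ a ∷ inst a v ++ φ (ψ lY w)) ++ b ∷ inst b (extendLeft (block s) n v′) ++ extend (block s) m (φ′ z)
      regroup b z = begin
        u ++ (a ∷ inst a v) ++ φ (ψ lY w ++ (b ∷ inst b v′) ++ φ′ z)
          ≡⟨ cong (λ y → u ++ (a ∷ inst a v) ++ y) (begin
            φ (ψ lY w ++ (b ∷ inst b v′) ++ φ′ z)   ≡⟨ cong φ (sym (++-assoc (ψ lY w) _ _)) ⟩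
            φ ((ψ lY w ++ b ∷ inst b v′) ++ φ′ z)   ≡⟨ sub-++ s _ (φ′ z) ⟩
            φ (ψ lY w ++ b ∷ inst b v′) ++ extend (block s) (length (ψ lY w ++ b ∷ inst b v′)) (φ′ z)
              ≡⟨ cong₂ (λ y l → y ++ extend (block s) l (φ′ z)) (sub-left s (ψ lY w) b v′)
                   (trans (length-++ (ψ lY w)) (cong (λ l → n + suc l) (length-inst b v′))) ⟩
            (φ (ψ lY w) ++ b ∷ inst b (extendLeft (block s) n v′)) ++ extend (block s) m (φ′ z)
              ≡⟨ ++-assoc (φ (ψ lY w)) _ _ ⟩
            φ (ψ lY w) ++ b ∷ inst b (extendLeft (block s) n v′) ++ extend (block s) m (φ′ z) ∎) ⟩
        u ++ (a ∷ inst a v) ++ φ (ψ lY w) ++ b ∷ inst b (extendLeft (block s) n v′) ++ extend (block s) m (φ′ z)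
          ≡⟨ cong (u ++_) (sym (++-assoc (a ∷ inst a v) _ _)) ⟩
        u ++ ((a ∷ inst a v) ++ φ (ψ lY w)) ++ b ∷ inst b (extendLeft (block s) n v′) ++ extend (block s) m (φ′ z)
          ≡⟨ sym (++-assoc u _ _) ⟩
        (u ++ a ∷ inst a v ++ φ (ψ lY w)) ++ b ∷ inst b (extendLeft (block s) n v′) ++ extend (block s) m (φ′ z) ∎

  -- The subspace obtained by iterating steps meets X; the step taken at a common point starts in X.
  memberStep : ∀ {X} → Large X → Σ[ s ∈ Step X ] X (Step.u s)
  memberStep lX with meets lX (ψ lX) (ψ-isSub lX)
    where open Iterate largeStep
  ... | w , x with Iterate.stepAt largeStep lX w
  ...   | v , φ , s , lY = step (Iterate.ψ largeStep lX w) v φ s lY , x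

  -- If X is large, every step of the second iteration starts in its current set, which keeps the
  -- subspace in X; otherwise failure of largeness is the second alternative.
  carlsonSimpson : ∀ X → ∃[ φ ] IsSub φ × ((∀ w → X (φ w)) ⊎ (∀ w → ¬ X (φ w)))
  carlsonSimpson X with em {P = Large X}
  ... | yes lX = ψ lX , ψ-isSub lX , inj₁ (ψ-∈ (proj₂ ∘ memberStep) lX)
    where open Iterate (proj₁ ∘ memberStep)
  ... | no ¬lX with avoided ¬lX
  ...   | φ , s , avoid = φ , s , inj₂ avoid

-- Equivalence relations as minimum maps.

-- at x is the minimum of the class of x.
record Part : Set where
  field
    at   : ℕ → ℕ
    reg  : ∀ x → at x ≤ x
    idem : ∀ x → at (at x) ≡ at x
    inf  : ∀ n → ∃[ m ] n ≤ m × at m ≡ m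

open Part public

Min : Part → ℕ → Set
Min A m = at A m ≡ m

infix 4 _⊑_
_⊑_ : Part → Part → Set
C ⊑ A = ∀ x → at C (at A x) ≡ at C x

Agree : ℕ → Part → Part → Set
Agree k A B = ∀ x → x < k → at A x ≡ at B x

-- C ∈ [rₙ(A), A], where k = μₙ(A).
record Box (k : ℕ) (A C : Part) : Set where
  constructor box
  field
    below : C ⊑ A
    agree : Agree k C A
    min   : Min C k

open Box public

⊑-trans : ∀ {A B C} → C ⊑ B → B ⊑ A → C ⊑ A
⊑-trans {A} {B} {C} C⊑B B⊑A x =
  trans (sym (C⊑B (at A x))) (trans (cong (at C) (B⊑A x)) (C⊑B x))

⊑-≤ : ∀ {A C} → C ⊑ A → ∀ x → at C x ≤ at A x
⊑-≤ {A} {C} C⊑A x = subst (_≤ at A x) (C⊑A x) (reg C (at A x))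

⊑-min : ∀ {A C m} → C ⊑ A → Min C m → Min A m
⊑-min {A} {C} {m} C⊑A Cm = ≤-antisym (reg A m) (subst (_≤ at A m) Cm (⊑-≤ {A} {C} C⊑A m))

min-< : ∀ {A B k m} → m < k → Agree k A B → Min B m → Min A m
min-< m<k ag Bm = trans (ag _ m<k) Bm

Agree-sym : ∀ {k A B} → Agree k A B → Agree k B A
Agree-sym ag x lt = sym (ag x lt)

Agree-trans : ∀ {k A B C} → Agree k A B → Agree k B C → Agree k A C
Agree-trans ag ag′ x lt = trans (ag x lt) (ag′ x lt)

Agree-≤ : ∀ {j k A B} → j ≤ k → Agree k A B → Agree j A B
Agree-≤ j≤k ag x lt = ag x (≤-trans lt j≤k)

Box-refl : ∀ {k A} → Min A k → Box k A A
Box-refl {A = A} Ak = box (idem A) (λ _ _ → refl) Ak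

Box-trans : ∀ {k A B C} → Box k A B → Box k B C → Box k A C
Box-trans {k} {A} {B} {C} (box l g m) (box l′ g′ m′) =
  box (⊑-trans {A} {B} {C} l′ l) (Agree-trans {k} {C} {B} {A} g′ g) m′

Box-≤ : ∀ {j k A B} → j ≤ k → Min A j → Box k A B → Box j A B
Box-≤ {A = A} {B} j≤k Aj (box l g m) with m≤n⇒m<n∨m≡n j≤k
... | inj₁ j<k  = box l (Agree-≤ {A = B} {A} j≤k g) (min-< {B} {A} j<k g Aj)
... | inj₂ refl = box l g m

Next : ℕ → Part → ℕ → Set
Next k C = IsLeast (λ m → k < m × Min C m)

least-above : ∀ A k → ∃ (Next k A)
least-above A k = least (λ m → (k <? m) ×-dec (at A m ≟ m)) (inf A (suc k))

-- amalgam lies in [k, A], and [B|k, amalgam] ⊆ [k, B].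
module Amalgamate {k : ℕ} {A B : Part} (Ak : Min A k) (B⊑A : B ⊑ A) (Bk : Min B k) where

  ρ : ℕ → ℕ
  ρ x with at A x <? k
  ... | yes _ = at A x
  ... | no  _ = at B x

  ρ-< : ∀ {x} → at A x < k → ρ x ≡ at A x
  ρ-< {x} lt with at A x <? k
  ... | yes _ = refl
  ... | no ≮  = contradiction lt ≮

  ρ-≥ : ∀ {x} → ¬ (at A x < k) → ρ x ≡ at B x
  ρ-≥ {x} ≮ with at A x <? k
  ... | yes lt = contradiction lt ≮
  ... | no _   = refl

  ρ-minB : ∀ {x} → Min B x → ρ x ≡ x
  ρ-minB {x} Bx with at A x <? k
  ... | yes _ = ⊑-min {A} {B} B⊑A Bx
  ... | no _  = Bx

  amalgam : Part
  amalgam .at = ρ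
  amalgam .reg x with at A x <? k
  ... | yes _ = reg A x
  ... | no _  = reg B x
  amalgam .idem x with at A x <? k
  ... | yes lt = trans (ρ-< (subst (_< k) (sym (idem A x)) lt)) (idem A x)
  ... | no _   = ρ-minB (idem B x)
  amalgam .inf n with inf B n
  ... | m , n≤m , Bm = m , n≤m , ρ-minB Bm

  amalgam-box : Box k A amalgam
  amalgam-box = box below′ agree′ (ρ-minB Bk)
    where
    below′ : amalgam ⊑ A
    below′ x with at A x <? k
    ... | yes lt = trans (ρ-< (subst (_< k) (sym (idem A x)) lt)) (idem A x)
    ... | no ≮   = trans (ρ-≥ (≮ ∘ subst (_< k) (idem A x))) (B⊑A x)
    agree′ : Agree k amalgam A
    agree′ x x<k = ρ-< (≤-<-trans (reg A x) x<k)

  -- Where `at A x` is below k, all values involved lie below k, where D equals B; elsewhere ρ is B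
  -- itself.
  amalgam-⊑ : ∀ {D} → D ⊑ amalgam → Agree k D B → D ⊑ B
  amalgam-⊑ {D} D⊑ ag x with at A x <? k in eq
  ... | no ≮ = trans (cong (at D) (sym (ρ-≥ ≮))) (D⊑ x)
  ... | yes lt = begin
    at D (at B x)          ≡⟨ ag (at B x) (≤-<-trans (⊑-≤ {A} {B} B⊑A x) lt) ⟩
    at B (at B x)          ≡⟨ idem B x ⟩
    at B x                 ≡⟨ sym (B⊑A x) ⟩
    at B (at A x)          ≡⟨ sym (ag (at A x) lt) ⟩
    at D (at A x)          ≡⟨ cong (at D) (sym (ρ-< lt)) ⟩
    at D (ρ x)             ≡⟨ D⊑ x ⟩
    at D x                 ∎
    where open ≡-Reasoning

-- [C|k, B] = [k, greatest].
module Greatest {k : ℕ} {B C : Part} (C⊑B : C ⊑ B) (Ck : Min C k) where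

  ρ : ℕ → ℕ
  ρ x with at B x <? k
  ... | yes _ = at C x
  ... | no  _ = at B x

  ρ-< : ∀ {x} → at B x < k → ρ x ≡ at C x
  ρ-< {x} lt with at B x <? k
  ... | yes _ = refl
  ... | no ≮  = contradiction lt ≮

  ρ-≥ : ∀ {x} → ¬ (at B x < k) → ρ x ≡ at B x
  ρ-≥ {x} ≮ with at B x <? k
  ... | yes lt = contradiction lt ≮
  ... | no _   = refl

  Bk : Min B k
  Bk = ⊑-min {B} {C} C⊑B Ck

  greatest : Part
  greatest .at = ρ
  greatest .reg x with at B x <? k
  ... | yes _ = reg C x
  ... | no _  = reg B x
  greatest .idem x with at B x <? k
  ... | yes lt = trans (ρ-< (≤-<-trans (reg B _) (≤-<-trans (⊑-≤ {B} {C} C⊑B x) lt))) (idem C x)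
  ... | no ≮   = trans (ρ-≥ (≮ ∘ subst (_< k) (idem B x))) (idem B x)
  greatest .inf n with inf B (n + k)
  ... | m , n+k≤m , Bm = m , ≤-trans (m≤m+n n k) n+k≤m ,
    trans (ρ-≥ (≤⇒≯ (≤-trans (m≤n+m k n) n+k≤m) ∘ subst (_< k) Bm)) Bm

  greatest-⊑ : greatest ⊑ B
  greatest-⊑ x with at B x <? k
  ... | yes lt = trans (ρ-< (subst (_< k) (sym (idem B x)) lt)) (C⊑B x)
  ... | no ≮   = trans (ρ-≥ (≮ ∘ subst (_< k) (idem B x))) (idem B x)

  greatest-min : Min greatest k
  greatest-min = trans (ρ-≥ (<-irrefl refl ∘ subst (_< k) Bk)) Bk

  greatest-box : ∀ {D} → D ⊑ B → Agree k D C → Min D k → Box k greatest D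
  greatest-box {D} D⊑B ag Dk = box below′ (λ x lt → trans (ag x lt) (sym (ρ-< (≤-<-trans (reg B x) lt)))) Dk
    where
    open ≡-Reasoning
    below′ : D ⊑ greatest
    below′ x with at B x <? k
    ... | no _ = D⊑B x
    ... | yes lt = begin
      at D (at C x)   ≡⟨ ag (at C x) C<k ⟩
      at C (at C x)   ≡⟨ idem C x ⟩
      at C x          ≡⟨ sym (C⊑B x) ⟩
      at C (at B x)   ≡⟨ sym (ag (at B x) lt) ⟩
      at D (at B x)   ≡⟨ D⊑B x ⟩
      at D x          ∎
      where
      C<k : at C x < k
      C<k = ≤-<-trans (⊑-≤ {B} {C} C⊑B x) lt

-- Fusion.

module Fusion (em : ∀ {ℓ} → ExcludedMiddle ℓ) (A : Part)
  (P : ℕ → Part → Set)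
  (hereditary : ∀ {k C D} → P k C → Box k C D → P k D)
  (dense : ∀ {k C} → C ⊑ A → Min C k → ∃[ B ] Box k C B × P k B)
  where

  -- Codes the restriction of C to {0,...,k-1}. Each k has finitely many codes, so one depth takes
  -- finitely many applications of density.
  code : ℕ → Part → List ℕ
  code k C = applyUpTo (at C) k

  code-agree : ∀ (f g : ℕ → ℕ) k → applyUpTo f k ≡ applyUpTo g k → ∀ x → x < k → f x ≡ g x
  code-agree f g (suc k) eq zero    lt       = ∷-injectiveˡ eq
  code-agree f g (suc k) eq (suc x) (s≤s lt) = code-agree (f ∘ suc) (g ∘ suc) k (∷-injectiveʳ eq) x lt

  codes : ℕ → List (List ℕ)
  codes k = tuples (upTo k) k

  code∈ : ∀ k C → code k C ∈ codes k
  code∈ k C = ∈-tuples k (code k C) (length-applyUpTo (at C) k)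
    (Allₚ.applyUpTo⁺₁ (at C) k λ {i} i<k → ∈-upTo⁺ (≤-<-trans (reg C i) i<k))

  -- Density is applied for each code in turn that still occurs below the current relation;
  -- `hereditary` carries the result to everything with that code.
  treat : ∀ {k} B → B ⊑ A → Min B k → ∀ (ts : List (List ℕ)) →
    ∃[ B′ ] Box k B B′ × (∀ C → C ⊑ B′ → Min C k → code k C ∈ ts → P k C)
  treat B B⊑A Bk [] = B , Box-refl Bk , λ _ _ _ ()
  treat {k} B B⊑A Bk (t ∷ ts) with treat B B⊑A Bk ts
  ... | B₁ , box₁ , P₁ with em {P = ∃[ C ] C ⊑ B₁ × Min C k × code k C ≡ t}
  ...   | no none = B₁ , box₁ , λ
    { C C⊑ Ck (here eq) → contradiction (C , C⊑ , Ck , eq) none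
    ; C C⊑ Ck (there t∈) → P₁ C C⊑ Ck t∈ }
  ...   | yes (C , C⊑B₁ , Ck , refl)
          with dense {C = C} (⊑-trans {A} {B} {C} (⊑-trans {B} {B₁} {C} C⊑B₁ (below box₁)) B⊑A) Ck
  ...     | E , boxE , PE = amalgam , Box-trans box₁ amalgam-box , result
    where
    -- E starts like C and not like `B₁`. Amalgamation returns to a member of [k, B₁] while keeping,
    -- for relations that start like C, the bound by E.
    open Amalgamate {k} {B₁} {E} (min box₁) (⊑-trans {B₁} {C} {E} (below boxE) C⊑B₁) (min boxE)
    result : ∀ D → D ⊑ amalgam → Min D k → code k D ∈ code k C ∷ ts → P k D
    result D D⊑ Dk (there t∈) = P₁ D (⊑-trans {B₁} {amalgam} {D} D⊑ (below amalgam-box)) Dk t∈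
    result D D⊑ Dk (here eq) = hereditary PE (box (amalgam-⊑ {D} D⊑ ag) ag Dk)
      where
      ag : Agree k D E
      ag x lt = trans (code-agree (at D) (at C) k eq x lt) (sym (agree boxE x lt))

  record Stage : Set where
    field
      part  : Part
      ⊑A    : part ⊑ A
      depth : ℕ
      depth-min : Min part depth
  open Stage

  treated : (S : Stage) → ∃[ B′ ] Box (depth S) (part S) B′ ×
    (∀ C → C ⊑ B′ → Min C (depth S) → P (depth S) C)
  treated S with treat (part S) (⊑A S) (depth-min S) (codes (depth S))
  ... | B′ , b , PB = B′ , b , λ C C⊑ Ck → PB C C⊑ Ck (code∈ (depth S) C)

  next : Stage → Stage
  next S = record
    { part = B′
    ; ⊑A = ⊑-trans {A} {part S} {B′} (below (proj₁ (proj₂ (treated S)))) (⊑A S)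
    ; depth = proj₁ least′
    ; depth-min = proj₂ (proj₁ (proj₂ least′)) }
    where
    B′ = proj₁ (treated S)
    least′ = least-above B′ (depth S)

  depth-next : ∀ S → depth S < depth (next S)
  depth-next S = proj₁ (proj₁ (proj₂ (least-above (part (next S)) (depth S))))

  depth-least : ∀ S {m} → depth S < m → Min (part (next S)) m → depth (next S) ≤ m
  depth-least S lt Bm = proj₂ (proj₂ (least-above (part (next S)) (depth S))) _ (lt , Bm)

  module _ {k₀ : ℕ} (Ak₀ : Min A k₀) where

    stage : ℕ → Stage
    stage zero    = record { part = A ; ⊑A = idem A ; depth = k₀ ; depth-min = Ak₀ }
    stage (suc i) = next (stage i)

    Bs : ℕ → Part
    Bs i = part (stage i)

    κ : ℕ → ℕ
    κ i = depth (stage i)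

    box-suc : ∀ i → Box (κ i) (Bs i) (Bs (suc i))
    box-suc i = proj₁ (proj₂ (treated (stage i)))

    i≤κ : ∀ i → i ≤ κ i
    i≤κ zero    = z≤n
    i≤κ (suc i) = ≤-trans (s≤s (i≤κ i)) (depth-next (stage i))

    κ-+ : ∀ i d → κ i ≤ κ (d + i)
    κ-+ i zero    = ≤-refl
    κ-+ i (suc d) = ≤-trans (κ-+ i d) (<⇒≤ (depth-next (stage (d + i))))

    box-+ : ∀ i d → Box (κ i) (Bs i) (Bs (d + i))
    box-+ i zero    = Box-refl (depth-min (stage i))
    box-+ i (suc d) = Box-trans (box-+ i d)
      (Box-≤ (κ-+ i d) (min (box-+ i d)) (box-suc (d + i)))

    box-stages : ∀ {i j} → i ≤ j → Box (κ i) (Bs i) (Bs j)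
    box-stages {i} {j} i≤j = subst (λ j → Box (κ i) (Bs i) (Bs j)) (m∸n+n≡m i≤j) (box-+ i (j ∸ i))

    -- The value at x is settled at stage `suc x`, whose depth exceeds x, since later stages agree
    -- below that depth.
    lim : ℕ → ℕ
    lim x = at (Bs (suc x)) x

    lim-eq : ∀ {x j} → x < κ j → lim x ≡ at (Bs j) x
    lim-eq {x} {j} lt with ≤-total (suc x) j
    ... | inj₁ le = sym (agree (box-stages le) x (i≤κ (suc x)))
    ... | inj₂ ge = agree (box-stages ge) x lt

    lim-κ : ∀ i → lim (κ i) ≡ κ i
    lim-κ i = trans (lim-eq {κ i} {suc i} (depth-next (stage i))) (min (box-suc i))

    fused : Part
    fused .at = lim
    fused .reg x = reg (Bs (suc x)) x
    fused .idem x = trans (lim-eq {lim x} {suc x} (≤-<-trans (reg (Bs (suc x)) x) (i≤κ (suc x)))) (idem (Bs (suc x)) x)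
    fused .inf n = κ n , i≤κ n , lim-κ n

    fused-⊑ : ∀ i → fused ⊑ Bs i
    fused-⊑ i x = begin
      lim (at (Bs i) x)   ≡⟨ lim-eq {j = j} (≤-<-trans (reg (Bs i) x) x<κ) ⟩
      at (Bs j) (at (Bs i) x) ≡⟨ below (box-stages {i} {j} (m≤m+n i (suc x))) x ⟩
      at (Bs j) x         ≡⟨ sym (lim-eq {j = j} x<κ) ⟩
      lim x               ∎
      where
      open ≡-Reasoning
      -- A stage past i whose depth exceeds x, and so also `at (Bs i) x`.
      j = i + suc x
      x<κ : x < κ j
      x<κ = ≤-trans (m≤n+m (suc x) i) (i≤κ j)

    -- A minimum of the limit is one of every stage, and stage `suc i` has none strictly between
    -- `κ i` and `κ (suc i)`.
    locate : ∀ {m} → k₀ ≤ m → Min fused m → ∃[ i ] m ≡ κ i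
    locate {m} k₀≤m fm = search m (i≤κ m)
      where
      search : ∀ i → m ≤ κ i → ∃[ i ] m ≡ κ i
      search zero    m≤ = 0 , ≤-antisym m≤ k₀≤m
      search (suc i) m≤ with m ≤? κ i
      ... | yes m≤κi = search i m≤κi
      ... | no m≰ = suc i , ≤-antisym m≤
        (depth-least (stage i) (≰⇒> m≰) (⊑-min {Bs (suc i)} {fused} (fused-⊑ (suc i)) fm))

    abstract
      fusion : ∃[ B ] Box k₀ A B × (∀ {k C} → k₀ ≤ k → C ⊑ B → Min C k → P k C)
      fusion = fused
        , box (fused-⊑ 0) (λ x lt → lim-eq {x} {0} lt) (lim-κ 0)
        , λ {k} {C} k₀≤k C⊑ Ck → everywhere C⊑ Ck (locate k₀≤k (⊑-min {fused} {C} C⊑ Ck))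
        where
        everywhere : ∀ {k C} → C ⊑ fused → Min C k → ∃[ i ] k ≡ κ i → P k C
        everywhere {C = C} C⊑ Ck (i , refl) =
          proj₂ (proj₂ (treated (stage i))) C (⊑-trans {Bs (suc i)} {fused} {C} C⊑ (fused-⊑ (suc i))) Ck

-- The pigeonhole principle for the next minimum.

nth : List ℕ → ℕ → ℕ
-- A default; the construction below reads lists within their length.
nth []       _       = 0
nth (x ∷ xs) zero    = x
nth (x ∷ xs) (suc i) = nth xs i

nth-++ˡ : ∀ xs {ys i} → i < length xs → nth (xs ++ ys) i ≡ nth xs i
nth-++ˡ (x ∷ xs) {i = zero}  lt       = refl
nth-++ˡ (x ∷ xs) {i = suc i} (s≤s lt) = nth-++ˡ xs lt

nth-++ʳ : ∀ xs {ys} i → nth (xs ++ ys) (length xs + i) ≡ nth ys i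
nth-++ʳ []       i = refl
nth-++ʳ (x ∷ xs) i = nth-++ʳ xs i

nth-map : ∀ f xs {i} → i < length xs → nth (map f xs) i ≡ f (nth xs i)
nth-map f (x ∷ xs) {zero}  lt       = refl
nth-map f (x ∷ xs) {suc i} (s≤s lt) = nth-map f xs lt

nth-All : ∀ {P : ℕ → Set} {xs i} → All P xs → i < length xs → P (nth xs i)
nth-All {i = zero}  (px ∷ _)   lt       = px
nth-All {i = suc i} (_  ∷ pxs) (s≤s lt) = nth-All pxs lt

module Pigeonhole (em : ∀ {ℓ} → ExcludedMiddle ℓ) (A : Part) {k : ℕ} (Ak : Min A k) where

  -- A relation C in [k, A], read at the minima p 0 < p 1 < … of A above k up to the next minimum
  -- of C, is a word; the letter a stands for the class of its minimum at A a ≤ k.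
  Letter : Set
  Letter = Fin (suc k)

  open Words Letter (allFin (suc k)) (λ a → ∈-allFin a)
  open Substitutions em Letter (allFin (suc k)) (λ a → ∈-allFin a) Fin.zero

  -- Several letters may name one class; it suffices that every minimum up to k is named.
  value : Letter → ℕ
  value a = at A (toℕ a)

  value-≤ : ∀ a → value a ≤ k
  value-≤ a = ≤-trans (reg A (toℕ a)) (toℕ≤pred[n] a)

  p : ℕ → ℕ
  p zero    = proj₁ (least-above A k)
  p (suc i) = proj₁ (least-above A (p i))

  p-min : ∀ i → Min A (p i)
  p-min zero    = proj₂ (proj₁ (proj₂ (least-above A k)))
  p-min (suc i) = proj₂ (proj₁ (proj₂ (least-above A (p i))))

  p-suc : ∀ i → p i < p (suc i)
  p-suc i = proj₁ (proj₁ (proj₂ (least-above A (p i))))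

  p-> : ∀ i → k < p i
  p-> zero    = proj₁ (proj₁ (proj₂ (least-above A k)))
  p-> (suc i) = <-trans (p-> i) (p-suc i)

  p-mono-< : ∀ {i j} → i < j → p i < p j
  p-mono-< {i} {suc j} (s≤s i≤j) with m≤n⇒m<n∨m≡n i≤j
  ... | inj₁ i<j  = <-trans (p-mono-< i<j) (p-suc j)
  ... | inj₂ refl = p-suc i

  p-cancel-< : ∀ {i j} → p i < p j → i < j
  p-cancel-< {i} {j} lt with i <? j
  ... | yes i<j = i<j
  ... | no i≮j with m≤n⇒m<n∨m≡n (≮⇒≥ i≮j)
  ...   | inj₁ j<i  = contradiction lt (<⇒≯ (p-mono-< j<i))
  ...   | inj₂ refl = contradiction lt (<-irrefl refl)

  p-injective : ∀ {i j} → p i ≡ p j → i ≡ j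
  p-injective {i} {j} eq with <-cmp i j
  ... | tri< i<j _ _ = contradiction eq (<⇒≢ (p-mono-< i<j))
  ... | tri≈ _ i≡j _ = i≡j
  ... | tri> _ _ j<i = contradiction (sym eq) (<⇒≢ (p-mono-< j<i))

  i<p : ∀ i → i ≤ p i
  i<p zero    = z≤n
  i<p (suc i) = ≤-<-trans (i<p i) (p-suc i)

  locate : ∀ x → at A x ≤ k ⊎ ∃[ i ] p i ≡ at A x
  locate x with at A x ≤? k
  ... | yes le = inj₁ le
  ... | no ≰ = inj₂ (search (at A x) (i<p (at A x)))
    where
    search : ∀ i → at A x ≤ p i → ∃[ i ] p i ≡ at A x
    search zero le = 0 , ≤-antisym (proj₂ (proj₂ (least-above A k)) _ (≰⇒> ≰ , idem A x)) le
    search (suc i) le with at A x ≤? p i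
    ... | yes le′ = search i le′
    ... | no ≰′ = suc i , ≤-antisym (proj₂ (proj₂ (least-above A (p i))) _ (≰⇒> ≰′ , idem A x)) le

  fixes-≤ : ∀ {C} → Box k A C → ∀ {y} → y ≤ k → Min A y → at C y ≡ y
  fixes-≤ b y≤k Ay with m≤n⇒m<n∨m≡n y≤k
  ... | inj₁ y<k  = trans (agree b _ y<k) Ay
  ... | inj₂ refl = min b

  -- Members of [k, A] fix the minima of A up to k, so they differ only in where they send the later
  -- minima `p q`.
  agree-p : ∀ {C D} s → Box k A C → Box k A D → (∀ q → q < s → at C (p q) ≡ at D (p q)) → Agree (p s) C D
  agree-p {C} {D} s bC bD eq x x<ps = trans (sym (below bC x)) (trans same (below bD x))
    where
    same : at C (at A x) ≡ at D (at A x)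
    same with locate x
    ... | inj₁ le = trans (fixes-≤ bC le (idem A x)) (sym (fixes-≤ bD le (idem A x)))
    ... | inj₂ (i , pi≡) rewrite sym pi≡ = eq i (p-cancel-< (≤-<-trans (subst (_≤ x) (sym pi≡) (reg A x)) x<ps))

  module Subspace {φ : Word → Word} (φ-isSub : IsSub φ) where
    open IsSub φ-isSub

    -- The values of the relation B at `p 0`, `p 1`, ...: a constant letter gives the class it
    -- names, and the variable with block n gives a new class whose minimum `pos n` is the place
    -- where that left variable word starts.
    entries : ℕ → List ℕ
    pos : ℕ → ℕ
    tail : ℕ → List ℕ
    entries zero    = map value (φ [])
    entries (suc n) = entries n ++ tail n
    pos n = p (length (entries n))
    tail n = pos n ∷ map (maybe′ value (pos n)) (block n)

    s : ℕ → ℕ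
    s n = length (entries n)

    s-suc : ∀ n → s n < s (suc n)
    s-suc n = subst (s n <_) (sym (length-++ (entries n))) (m<m+n (s n) z<s)

    n≤s : ∀ n → n ≤ s n
    n≤s zero    = z≤n
    n≤s (suc n) = ≤-<-trans (n≤s n) (s-suc n)

    s-mono : ∀ {m n} → m ≤ n → s m ≤ s n
    s-mono {n = zero}  z≤n = ≤-refl
    s-mono {m} {suc n} m≤ with m≤n⇒m<n∨m≡n m≤
    ... | inj₁ (s≤s m≤n) = ≤-trans (s-mono m≤n) (<⇒≤ (s-suc n))
    ... | inj₂ refl      = ≤-refl

    nth-stable : ∀ {m n q} → m ≤ n → q < s m → nth (entries n) q ≡ nth (entries m) q
    nth-stable {n = zero}  z≤n lt = refl
    nth-stable {m} {suc n} m≤ lt with m≤n⇒m<n∨m≡n m≤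
    ... | inj₁ (s≤s m≤n) = trans (nth-++ˡ (entries n) (<-≤-trans lt (s-mono m≤n))) (nth-stable m≤n lt)
    ... | inj₂ refl      = refl

    lim : ℕ → ℕ
    lim q = nth (entries (suc q)) q

    lim-entries : ∀ n {q} → q < s n → lim q ≡ nth (entries n) q
    lim-entries n {q} lt with ≤-total (suc q) n
    ... | inj₁ le = sym (nth-stable le (n≤s (suc q)))
    ... | inj₂ ge = nth-stable ge lt

    lim-start : ∀ n → lim (s n) ≡ pos n
    lim-start n = trans (lim-entries (suc n) (s-suc n))
      (trans (cong (nth (entries (suc n))) (sym (+-identityʳ (s n)))) (nth-++ʳ (entries n) 0))

    -- Values of both kinds are fixed by B, whence idempotence; the bound on `s n` gives
    -- `lim q ≤ p q`.
    Entry : ℕ → ℕ → Set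
    Entry q v = (v ≤ k × Min A v) ⊎ (∃[ n ] s n ≤ q × v ≡ pos n)

    entry : ∀ n {q} → q < s n → Entry q (nth (entries n) q)
    entry zero lt = inj₁ (nth-All {λ v → v ≤ k × Min A v} (Allₚ.map⁺ {xs = φ []} (All.tabulate λ {a} _ → value-≤ a , idem A (toℕ a))) lt)
    entry (suc n) {q} lt with q <? s n
    ... | yes q<sn = subst (Entry q) (sym (nth-++ˡ (entries n) q<sn)) (entry n q<sn)
    ... | no q≮sn = subst (Entry q) (trans (sym (nth-++ʳ (entries n) (q ∸ s n))) (cong (nth (entries (suc n))) eq))
        (nth-All tail-entries (+-cancelˡ-< (s n) _ _ (subst₂ _<_ (sym eq) (length-++ (entries n)) lt)))
      where
      eq : s n + (q ∸ s n) ≡ q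
      eq = m+[n∸m]≡n (≮⇒≥ q≮sn)
      new : ∀ m → Entry q (maybe′ value (pos n) m)
      new (just a) = inj₁ (value-≤ a , idem A (toℕ a))
      new nothing  = inj₂ (n , ≮⇒≥ q≮sn , refl)
      tail-entries : All (Entry q) (tail n)
      tail-entries = new nothing ∷ Allₚ.map⁺ (All.tabulate λ {m} _ → new m)

    entry-lim : ∀ q → Entry q (lim q)
    entry-lim q = entry (suc q) (n≤s (suc q))

    bAt : ℕ → ℕ
    bAt x with locate x
    ... | inj₁ _       = at A x
    ... | inj₂ (i , _) = lim i

    b-≤ : ∀ {x} → at A x ≤ k → bAt x ≡ at A x
    b-≤ {x} le with locate x
    ... | inj₁ _ = refl
    ... | inj₂ (i , eq) = contradiction (subst (_≤ k) (sym eq) le) (<⇒≱ (p-> i))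

    b-p : ∀ {x} i → at A x ≡ p i → bAt x ≡ lim i
    b-p {x} i eq with locate x
    ... | inj₁ le = contradiction (subst (_≤ k) eq le) (<⇒≱ (p-> i))
    ... | inj₂ (j , eq′) = cong lim (p-injective {j} {i} (trans eq′ eq))

    b-pos : ∀ n → bAt (pos n) ≡ pos n
    b-pos n = trans (b-p (s n) (p-min (s n))) (lim-start n)

    lim-≤ : ∀ i → lim i ≤ p i
    lim-≤ i with entry-lim i
    ... | inj₁ (le , _) = ≤-trans le (<⇒≤ (p-> i))
    ... | inj₂ (n , sn≤i , eq) with m≤n⇒m<n∨m≡n sn≤i
    ...   | inj₁ lt   = ≤-trans (≤-reflexive eq) (<⇒≤ (p-mono-< lt))
    ...   | inj₂ refl = ≤-reflexive eq

    B : Part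
    B .at = bAt
    B .reg x with locate x
    ... | inj₁ _       = reg A x
    ... | inj₂ (i , eq) = ≤-trans (lim-≤ i) (subst (_≤ x) (sym eq) (reg A x))
    B .idem x with locate x
    ... | inj₁ le = trans (b-≤ (subst (_≤ k) (sym (idem A x)) le)) (idem A x)
    ... | inj₂ (i , eq) with entry-lim i
    ...   | inj₁ (le , AE) = trans (b-≤ (subst (_≤ k) (sym AE) le)) AE
    ...   | inj₂ (n , _ , eqE) = trans (cong bAt eqE) (trans (b-pos n) (sym eqE))
    B .inf n = pos n , ≤-trans (n≤s n) (i<p (s n)) , b-pos n

    B⊑A : B ⊑ A
    B⊑A x with locate x
    ... | inj₁ le = trans (b-≤ (subst (_≤ k) (sym (idem A x)) le)) (idem A x)
    ... | inj₂ (i , eq) = b-p i (trans (idem A x) (sym eq))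

    boxB : Box k A B
    boxB = box B⊑A (λ x lt → b-≤ (≤-trans (reg A x) (<⇒≤ lt))) (trans (b-≤ (≤-reflexive Ak)) Ak)

    module Read {C : Part} (bC : Box k B C) {j : ℕ} (lj : Next k C j) where

      boxC : Box k A C
      boxC = Box-trans boxB bC

      k<j = proj₁ (proj₁ lj)
      Cj  = proj₂ (proj₁ lj)

      -- Minima of C are minima of B, so j is a value of B; exceeding k, it is the minimum of a new
      -- class.
      position : ∃[ n ] j ≡ pos n
      position with locate j
      ... | inj₁ le = contradiction (subst (_≤ k) (⊑-min {A} {C} (below boxC) Cj) le) (<⇒≱ k<j)
      ... | inj₂ (i , pi≡Aj) with entry-lim i
      ...   | inj₁ (le , _) = contradiction (subst (_≤ k) Ei≡j le) (<⇒≱ k<j)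
        where
        Ei≡j : lim i ≡ j
        Ei≡j = trans (sym (b-p i (sym pi≡Aj))) (⊑-min {B} {C} (below bC) Cj)
      ...   | inj₂ (n , _ , Ei≡pos) =
        n , trans (sym (⊑-min {B} {C} (below bC) Cj)) (trans (b-p i (sym pi≡Aj)) Ei≡pos)

      small : ∀ {x} → x < j → at C x ≤ k
      small {x} x<j = ≮⇒≥ λ k<Cx → <⇒≱ x<j (≤-trans (proj₂ lj (at C x) (k<Cx , idem C x)) (reg C x))

      C-value : ∀ a → at C (value a) ≡ value a
      C-value a = fixes-≤ boxC (value-≤ a) (idem A (toℕ a))

      n : ℕ
      n = proj₁ position

      -- Below its next minimum j, C sends each `pos m` to a class with minimum at most k, that is,
      -- to a letter. These letters fill the variables and form w.
      reading : ∀ m → m ≤ n → ∃[ w ] length w ≡ m × map (at C) (entries m) ≡ map value (φ w)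
      reading zero _ = [] , refl , trans (sym (map-∘ (φ []))) (map-cong C-value (φ []))
      reading (suc m) m<n with reading m (<⇒≤ m<n)
      ... | w , refl , eq = w ++ [ a ] , trans (length-++ w) (+-comm m 1) , (begin
          map (at C) (entries m ++ tail m)                     ≡⟨ map-++ (at C) (entries m) (tail m) ⟩
          map (at C) (entries m) ++ map (at C) (tail m)
            ≡⟨ cong₂ (λ x y → x ++ y) eq (cong₂ _∷_ Ca (trans (sym (map-∘ (block m))) (trans (map-cong Cm (block m)) (map-∘ (block m))))) ⟩
          map value (φ w) ++ map value (a ∷ inst a (block m)) ≡⟨ sym (map-++ value (φ w) _) ⟩
          map value (φ w ++ a ∷ inst a (block m))           ≡⟨ cong (map value) (sym (snoc w a)) ⟩
          map value (φ (w ++ [ a ]))                        ∎)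
        where
        open ≡-Reasoning
        le : at C (pos m) ≤ k
        le = small (subst (pos m <_) (sym (proj₂ position)) (p-mono-< (<-≤-trans (s-suc m) (s-mono m<n))))
        a : Letter
        a = fromℕ< (s≤s le)
        Ca : at C (pos m) ≡ value a
        Ca = sym (trans (cong (at A) (toℕ-fromℕ< (s≤s le))) (⊑-min {A} {C} (below boxC) (idem C (pos m))))
        Cm : ∀ l → at C (maybe′ value (pos m) l) ≡ value (fromMaybe a l)
        Cm (just b) = C-value b
        Cm nothing  = Ca

      readWord : ∃[ w ] j ≡ p (length (φ w)) × (∀ q → q < length (φ w) → at C (p q) ≡ nth (map value (φ w)) q)
      readWord with reading n ≤-refl
      ... | w , _ , eq = w , trans (proj₂ position) (cong p s≡) , λ q lt → begin
          at C (p q)                ≡⟨ sym (below bC (p q)) ⟩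
          at C (bAt (p q))          ≡⟨ cong (at C) (trans (b-p q (p-min q)) (lim-entries n (subst (q <_) (sym s≡) lt))) ⟩
          at C (nth (entries n) q)      ≡⟨ sym (nth-map (at C) (entries n) (subst (q <_) (sym s≡) lt)) ⟩
          nth (map (at C) (entries n)) q ≡⟨ cong (λ l → nth l q) eq ⟩
          nth (map value (φ w)) q    ∎
        where
        open ≡-Reasoning
        s≡ : s n ≡ length (φ w)
        s≡ = trans (sym (length-map (at C) (entries n))) (trans (cong length eq) (length-map value (φ w)))

  abstract
    -- A word is coloured by whether some relation reading it satisfies `c`. The choice of that
    -- relation is immaterial, since `c` sees only the restriction below the position reached.
    pigeonhole : (c : ℕ → Part → Set) → (∀ {j C D} → Agree j D C → c j C → c j D) →
      ∃[ B ] Box k A B ×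
        ((∀ {C j} → Box k B C → Next k C j → c j C) ⊎
         (∀ {C j} → Box k B C → Next k C j → ¬ c j C))
    pigeonhole c c-resp with carlsonSimpson (λ w → ∃[ C ] Box k A C ×
        (∀ q → q < length w → at C (p q) ≡ nth (map value w) q) × c (p (length w)) C)
    ... | φ , φ-isSub , inj₁ all = B , boxB , inj₁ result
      where
      open Subspace φ-isSub
      result : ∀ {C j} → Box k B C → Next k C j → c j C
      result {C} bC lj with Read.readWord bC lj
      ... | w , refl , eqC with all w
      ...   | D , bD , eqD , cD = c-resp (agree-p {C} {D} _ (Box-trans boxB bC) bD λ q lt → trans (eqC q lt) (sym (eqD q lt))) cD
    ... | φ , φ-isSub , inj₂ none = B , boxB , inj₂ result
      where
      open Subspace φ-isSub
      result : ∀ {C j} → Box k B C → Next k C j → ¬ c j C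
      result {C} bC lj cC with Read.readWord bC lj
      ... | w , refl , eqC = none w (C , Box-trans boxB bC , eqC , cC)

-- Ramsey sets.

All-of None-of : (Part → Set) → ℕ → Part → Set
All-of  V k A = ∀ C → Box k A C → V C
None-of V k A = ∀ C → Box k A C → ¬ V C

Homogeneous : (Part → Set) → ℕ → Part → Set
Homogeneous V k A = All-of V k A ⊎ None-of V k A

Homogeneous-box : ∀ {V k A B} → Homogeneous V k A → Box k A B → Homogeneous V k B
Homogeneous-box (inj₁ all)  b = inj₁ λ C bC → all C (Box-trans b bC)
Homogeneous-box (inj₂ none) b = inj₂ λ C bC → none C (Box-trans b bC)

-- Basic sets [k, A] suffice: by `Greatest`, every nonempty [t, A] has this form.
Ramsey : (Part → Set) → Set
Ramsey V = ∀ {k A} → Min A k → ∃[ B ] Box k A B × Homogeneous V k B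

Ramsey-∁ : ∀ {V} → Ramsey V → Ramsey (λ C → ¬ V C)
Ramsey-∁ ram Ak with ram Ak
... | B , b , inj₁ all  = B , b , inj₂ λ C bC ¬v → ¬v (all C bC)
... | B , b , inj₂ none = B , b , inj₁ none

Ramsey-resp : ∀ {V W : Part → Set} → (∀ {C} → V C → W C) → (∀ {C} → W C → V C) → Ramsey V → Ramsey W
Ramsey-resp to from ram Ak with ram Ak
... | B , b , inj₁ all  = B , b , inj₁ λ C bC → to (all C bC)
... | B , b , inj₂ none = B , b , inj₂ λ C bC → none C bC ∘ from

Ramsey-simultaneous : ∀ {I : Set} {V : I → Part → Set} → (∀ i → Ramsey (V i)) → (is : List I) →
  ∀ {k A} → Min A k → ∃[ B ] Box k A B × (∀ {i} → i ∈ is → Homogeneous (V i) k B)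
Ramsey-simultaneous ram [] Ak = _ , Box-refl Ak , λ ()
Ramsey-simultaneous ram (i ∷ is) Ak with Ramsey-simultaneous ram is Ak
... | B , b , hom with ram i (min b)
...   | C , c , homC = C , Box-trans b c , λ
  { (here refl) → homC
  ; (there j∈)  → Homogeneous-box (hom j∈) c }

-- Combinatorial forcing and countable unions.

module Ellentuck (em : ∀ {ℓ} → ExcludedMiddle ℓ) where

  module Forcing (V : Part → Set) {k₀ : ℕ} {A : Part} (Ak₀ : Min A k₀)
    (openV : ∀ C → Box k₀ A C → V C → ∃[ j ] Min C j × All-of V j C) where

    Accepts Rejects : ℕ → Part → Set
    Accepts   = All-of V
    Rejects k = None-of (Accepts k) k

    Accepts-box : ∀ {k C D} → Accepts k C → Box k C D → Accepts k D
    Accepts-box acc b E bE = acc E (Box-trans b bE)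

    Rejects-box : ∀ {k C D} → Rejects k C → Box k C D → Rejects k D
    Rejects-box rej b E bE = rej E (Box-trans b bE)

    Decided : ℕ → Part → Set
    Decided k C = Accepts k C ⊎ Rejects k C

    Decided-box : ∀ {k C D} → Decided k C → Box k C D → Decided k D
    Decided-box (inj₁ acc) b = inj₁ (Accepts-box acc b)
    Decided-box (inj₂ rej) b = inj₂ (Rejects-box rej b)

    Decided-dense : ∀ {k C} → C ⊑ A → Min C k → ∃[ B ] Box k C B × Decided k B
    Decided-dense {k} {C} _ Ck with em {P = ∃[ D ] Box k C D × Accepts k D}
    ... | yes (D , b , acc) = D , b , inj₁ acc
    ... | no none = C , Box-refl Ck , inj₂ λ D b acc → none (D , b , acc)

    fusion₁ : ∃[ B ] Box k₀ A B × (∀ {k C} → k₀ ≤ k → C ⊑ B → Min C k → Decided k C)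
    fusion₁ = Fusion.fusion em A Decided Decided-box Decided-dense Ak₀

    module Forced {B₁ : Part} (box₁ : Box k₀ A B₁)
      (decided : ∀ {k C} → k₀ ≤ k → C ⊑ B₁ → Min C k → Decided k C) where

      -- The `greatest` relation is decided and cannot reject, as C lies in its basic set and
      -- accepts; D lies there too.
      Accepts-agree : ∀ {k C D} → k₀ ≤ k → C ⊑ B₁ → D ⊑ B₁ → Min C k → Min D k → Agree k D C →
        Accepts k C → Accepts k D
      Accepts-agree {k} {C} {D} k₀≤k C⊑ D⊑ Ck Dk ag acc with decided k₀≤k greatest-⊑ greatest-min
        where open Greatest {k} {B₁} {C} C⊑ Ck
      ... | inj₁ accG = Accepts-box accG (Greatest.greatest-box {k} {B₁} {C} C⊑ Ck D⊑ ag Dk)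
      ... | inj₂ rejG = contradiction acc
        (rejG C (Greatest.greatest-box {k} {B₁} {C} C⊑ Ck C⊑ (λ _ _ → refl) Ck))

      -- The guard makes the property trivial below `k₀`, where `decided` says nothing, because
      -- fusion asks for density at every k.
      Spreads : ℕ → Part → Set
      Spreads k C = k₀ ≤ k → Accepts k C ⊎ (∀ D j → Box k C D → Next k D j → Rejects j D)

      Spreads-box : ∀ {k C D} → Spreads k C → Box k C D → Spreads k D
      Spreads-box sp b k₀≤k with sp k₀≤k
      ... | inj₁ acc = inj₁ (Accepts-box acc b)
      ... | inj₂ rej = inj₂ λ E j bE → rej E j (Box-trans b bE)

      Spreads-dense : ∀ {k C} → C ⊑ B₁ → Min C k → ∃[ B ] Box k C B × Spreads k B
      Spreads-dense {k} {C} C⊑ Ck with k₀ ≤? k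
      ... | no ≰ = C , Box-refl Ck , λ le → contradiction le ≰
      ... | yes k₀≤k with Pigeonhole.pigeonhole em C Ck
            -- Acceptance is stated through some E agreeing with D, so that the colour depends on
            -- the restriction of D alone.
            (λ j D → ∃[ E ] E ⊑ B₁ × Agree j E D × Min E j × Accepts j E)
            (λ {j} {D} {D′} ag (E , E⊑ , agE , Ej , acc) →
               E , E⊑ , Agree-trans {j} {E} {D} {D′} agE (Agree-sym {j} {D′} {D} ag) , Ej , acc)
      -- Each D in [k, B] accepts at its next minimum, hence belongs to V; so B accepts at k.
      ...   | B , b , inj₁ all = B , b , λ _ → inj₁ λ D bD →
        let j , lj = least-above D k
            E , E⊑ , agE , Ej , acc = all bD lj
            Dj = proj₂ (proj₁ lj)
        in Accepts-agree (≤-trans k₀≤k (<⇒≤ (proj₁ (proj₁ lj)))) E⊑ (D⊑B₁ bD b) Ej Dj (Agree-sym {j} {E} {D} agE) acc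
             D (Box-refl Dj)
        where
        D⊑B₁ : ∀ {B D} → Box k B D → Box k C B → D ⊑ B₁
        D⊑B₁ {B} {D} bD b = ⊑-trans {B₁} {C} {D} (⊑-trans {C} {B} {D} (below bD) (below b)) C⊑
      ...   | B , b , inj₂ none = B , b , λ _ → inj₂ λ D j bD lj →
        case decided (≤-trans k₀≤k (<⇒≤ (proj₁ (proj₁ lj))))
               (⊑-trans {B₁} {C} {D} (⊑-trans {C} {B} {D} (below bD) (below b)) C⊑) (proj₂ (proj₁ lj)) of λ
          { (inj₁ acc) → contradiction
              (D , ⊑-trans {B₁} {C} {D} (⊑-trans {C} {B} {D} (below bD) (below b)) C⊑ , (λ _ _ → refl) , proj₂ (proj₁ lj) , acc)
              (none bD lj)
          ; (inj₂ rej) → rej }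

      fusion₂ : ∃[ B ] Box k₀ B₁ B × (∀ {k C} → k₀ ≤ k → C ⊑ B → Min C k → Spreads k C)
      fusion₂ = Fusion.fusion em B₁ Spreads Spreads-box Spreads-dense (min box₁)

      module Spread {B₂ : Part} (box₂ : Box k₀ B₁ B₂)
        (spreads : ∀ {k C} → k₀ ≤ k → C ⊑ B₂ → Min C k → Spreads k C) where

        -- Rejection excludes the accepting case of `Spreads` and so passes from one minimum of C to
        -- the next; d bounds the distance still to go.
        spread : ∀ {C} → C ⊑ B₂ → ∀ d {k j} → k₀ ≤ k → Min C k → Rejects k C → k ≤ j → j ≤ d + k → Min C j → Rejects j C
        spread {C} C⊑ d {k} {j} k₀≤k Ck rej k≤j j≤ Cj with m≤n⇒m<n∨m≡n k≤j
        ... | inj₂ refl = rej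
        spread {C} C⊑ zero k₀≤k Ck rej k≤j j≤ Cj | inj₁ k<j = contradiction j≤ (<⇒≱ k<j)
        spread {C} C⊑ (suc d) {k} {j} k₀≤k Ck rej k≤j j≤ Cj | inj₁ k<j with spreads k₀≤k C⊑ Ck k₀≤k
        ... | inj₁ acc = contradiction acc (rej C (Box-refl Ck))
        ... | inj₂ rejs with least-above C k
        ...   | l , (k<l , Cl) , l≤ = spread C⊑ d (≤-trans k₀≤k (<⇒≤ k<l)) Cl (rejs C l (Box-refl Ck) ((k<l , Cl) , l≤))
          (l≤ j (k<j , Cj)) (≤-trans j≤ (subst (_≤ d + l) (+-suc d k) (+-monoʳ-≤ d k<l))) Cj

        homogeneous : ∃[ B ] Box k₀ A B × Homogeneous V k₀ B
        homogeneous with decided ≤-refl (below box₂) (min box₂)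
        ... | inj₁ acc = B₂ , Box-trans box₁ box₂ , inj₁ acc
        ... | inj₂ rej = B₂ , Box-trans box₁ box₂ , inj₂ avoids
          where
          avoids : None-of V k₀ B₂
          -- By openness a member C of V accepts at some j, but rejection has spread to j; if j is
          -- below `k₀`, acceptance passes up to `k₀`.
          avoids C b v with openV C (Box-trans box₁ (Box-trans box₂ b)) v
          ... | j , Cj , acc with k₀ ≤? j
          ...   | yes k₀≤j = spread (below b) j ≤-refl (min b) (Rejects-box rej b) k₀≤j (m≤m+n j k₀) Cj C (Box-refl Cj) acc
          ...   | no k₀≰j = rej C b λ D bD → acc D (Box-≤ (<⇒≤ (≰⇒> k₀≰j)) Cj bD)

    homogeneous : ∃[ B ] Box k₀ A B × Homogeneous V k₀ B
    homogeneous =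
      let B₁ , box₁ , decided = fusion₁
          B₂ , box₂ , spreads = Forced.fusion₂ box₁ decided
      in Forced.Spread.homogeneous box₁ decided box₂ spreads

  Ramsey-open : ∀ {V} → (∀ C → V C → ∃[ j ] Min C j × All-of V j C) → Ramsey V
  Ramsey-open openV Ak = Forcing.homogeneous _ Ak λ C _ → openV C

  -- After fusion, C below B is homogeneous for `V n` at its minima beyond n and at least `k₀`. If C
  -- is in `V n`, then so is all of [j, C] at such a j, and the union is open below B.
  Ramsey-⋃ : ∀ {V : ℕ → Part → Set} → (∀ n → Ramsey (V n)) → Ramsey (λ C → ∃[ n ] V n C)
  Ramsey-⋃ {V} ram {k₀} {A} Ak₀ with Fusion.fusion em A
    (λ k C → ∀ {n} → n ∈ upTo k → Homogeneous (V n) k C)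
    (λ hom b n∈ → Homogeneous-box (hom n∈) b)
    (λ {k} _ Ck → Ramsey-simultaneous ram (upTo k) Ck) Ak₀
  ... | B , b , hom with Forcing.homogeneous (λ C → ∃[ n ] V n C) (min b) openV
    where
    openV : ∀ C → Box k₀ B C → ∃[ n ] V n C → ∃[ j ] Min C j × All-of (λ C → ∃[ n ] V n C) j C
    openV C bC (n , v) with inf C (suc n + k₀)
    ... | j , ≤j , Cj with hom (≤-trans (m≤n+m k₀ (suc n)) ≤j) (below bC) Cj (∈-upTo⁺ (≤-trans (m≤m+n (suc n) k₀) ≤j))
    ...   | inj₁ all  = j , Cj , λ D bD → n , all D bD
    ...   | inj₂ none = contradiction v (none C (Box-refl Cj))
  ...   | D , bD , homD = D , Box-trans b bD , homD

-- Translation between the two encodings of equivalence relations.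

T-ext : ∀ {a b} → (T a → T b) → (T b → T a) → a ≡ b
T-ext {false} {false} _ _ = refl
T-ext {false} {true}  _ g = contradiction (g tt) id
T-ext {true}  {false} f _ = contradiction (f tt) id
T-ext {true}  {true}  _ _ = refl

fromPart : Part → E∞
fromPart P = record
  { χ = λ i j → ⌊ at P i ≟ at P j ⌋
  ; isEquivalence = record
    { refl  = fromWitness refl
    ; sym   = λ e → fromWitness (sym (toWitness e))
    ; trans = λ e e′ → fromWitness (trans (toWitness e) (toWitness e′)) }
  ; infinite = λ xs → let m , lt , Pm = inf P (suc (max 0 xs)) in
      m , Allₚ.All¬⇒¬Any (All.map (λ {x} x≤ e → <⇒≢ (≤-<-trans (≤-trans (reg P x) x≤) lt)
        (trans (sym (toWitness e)) Pm)) (xs≤max 0 xs)) }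

module _ (A : E∞) where
  open E∞ A
  private module A = IsEquivalence isEquivalence

  leastRelated : ∀ x → ∃ (IsLeast (λ y → y ∼ x))
  leastRelated x = least (λ y → T? (χ y x)) (x , A.refl)

  rep : ℕ → ℕ
  rep x = proj₁ (leastRelated x)

  rep-∼ : ∀ x → rep x ∼ x
  rep-∼ x = proj₁ (proj₂ (leastRelated x))

  rep-least : ∀ {x y} → y ∼ x → rep x ≤ y
  rep-least {x} = proj₂ (proj₂ (leastRelated x)) _

  rep-cong : ∀ {x y} → x ∼ y → rep x ≡ rep y
  rep-cong x∼y = ≤-antisym (rep-least (A.trans (rep-∼ _) (A.sym x∼y))) (rep-least (A.trans (rep-∼ _) x∼y))

  rep-cancel : ∀ {x y} → rep x ≡ rep y → x ∼ y
  rep-cancel {x} {y} eq = A.trans (A.sym (rep-∼ x)) (subst (_∼ y) (sym eq) (rep-∼ y))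

  rep-minimum : ∀ {m} → IsMinimum A m → rep m ≡ m
  rep-minimum {m} (a , m∼a , m≤) = ≤-antisym (rep-least A.refl) (m≤ (rep m) (A.trans (rep-∼ m) m∼a))

  toPart : Part
  toPart .at   = rep
  toPart .reg x = rep-least A.refl
  toPart .idem x = rep-cong (rep-∼ x)
  toPart .inf n with minimum-unbounded A n
  ... | m , n≤m , mm = m , n≤m , rep-minimum mm

  -- Allows f, which respects `_≈_`, to be studied on relations of the form `fromPart P`.
  from-to : A ≈ fromPart toPart
  from-to i j = T-ext (λ e → fromWitness (rep-cong e)) (λ e → rep-cancel (toWitness e))

Min⇒IsMinimum : ∀ P {m} → Min P m → IsMinimum (fromPart P) m
Min⇒IsMinimum P {m} Pm = m , fromWitness refl , λ k e →
  subst (_≤ k) (trans (toWitness e) Pm) (reg P k)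

IsMinimum⇒Min : ∀ P {m} → IsMinimum (fromPart P) m → Min P m
IsMinimum⇒Min P {m} (a , e , m≤) = ≤-antisym (reg P m) (m≤ (at P m) (fromWitness (trans (idem P m) (toWitness e))))

≈fin-trans : ∀ {s t u} → s ≈fin t → t ≈fin u → s ≈fin u
≈fin-trans {s} {t} {u} (refl , p) (refl , q) = refl , λ i j →
  trans (p i j) (trans (q _ _) (cong₂ (Efin.χ u) (cast-trans refl refl i) (cast-trans refl refl j)))

≈fin-sym : ∀ {s t} → s ≈fin t → t ≈fin s
≈fin-sym {s} {t} (refl , p) = refl , λ i j →
  sym (trans (p _ _) (cong₂ (Efin.χ t)
    (trans (cast-trans refl refl i) (cast-is-id refl i)) (trans (cast-trans refl refl j) (cast-is-id refl j))))

restrict-≈ : ∀ {A B k l} → k ≡ l → (∀ i j → i < k → j < k → E∞.χ A i j ≡ E∞.χ B i j) → restrict A k ≈fin restrict B l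
restrict-≈ {A} {B} refl eq = refl , λ i j → trans (eq (toℕ i) (toℕ j) (toℕ<n i) (toℕ<n j))
  (cong₂ (E∞.χ B) (sym (toℕ-cast refl i)) (sym (toℕ-cast refl j)))

≈-restrict : ∀ {A B k l} → restrict A k ≈fin restrict B l →
  ∀ i j → i < k → j < k → E∞.χ A i j ≡ E∞.χ B i j
≈-restrict {A} {B} (refl , p) i j i<k j<k = begin
  E∞.χ A i j                    ≡⟨ cong₂ (E∞.χ A) (sym (toℕ-fromℕ< i<k)) (sym (toℕ-fromℕ< j<k)) ⟩
  E∞.χ A (toℕ i′) (toℕ j′)      ≡⟨ p i′ j′ ⟩
  E∞.χ B (toℕ (cast refl i′)) (toℕ (cast refl j′))
    ≡⟨ cong₂ (E∞.χ B) (trans (toℕ-cast refl i′) (toℕ-fromℕ< i<k)) (trans (toℕ-cast refl j′) (toℕ-fromℕ< j<k)) ⟩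
  E∞.χ B i j                    ∎
  where
  open ≡-Reasoning
  i′ = fromℕ< i<k
  j′ = fromℕ< j<k

Agree⇒χ : ∀ {k P Q} → Agree k P Q → ∀ i j → i < k → j < k → E∞.χ (fromPart P) i j ≡ E∞.χ (fromPart Q) i j
Agree⇒χ ag i j i<k j<k = cong₂ (λ x y → ⌊ x ≟ y ⌋) (ag i i<k) (ag j j<k)

-- Open sets in terms of minimum maps.

OpenPart : Pred E∞ 0ℓ → Set
OpenPart V = ∀ P → V (fromPart P) →
  ∃[ k ] Min P k × (∀ Q → Min Q k → Agree k Q P → V (fromPart Q))

-- An intersection takes the larger of two minima; the smaller stays a minimum of Q by agreement.
-- Since Q need not lie below P, the result implies Ellentuck-openness.
Open⇒OpenPart : ∀ {V} → Open V → OpenPart V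
Open⇒OpenPart (subbasic s) P (n , rn≈s) = μ A n , IsMinimum⇒Min P (μ-isMinimum A n) , nearby
  where
  A = fromPart P
  nearby : ∀ Q → Min Q (μ A n) → Agree (μ A n) Q P → Cylinder s (fromPart Q)
  nearby Q Qk ag with μ-surjective (fromPart Q) (Min⇒IsMinimum Q Qk)
  ... | m , eq = m , ≈fin-trans {r m (fromPart Q)} {r n A} {s}
    (restrict-≈ {fromPart Q} {A} eq (Agree⇒χ {_} {Q} {P} λ x lt → ag x (subst (x <_) eq lt))) rn≈s
Open⇒OpenPart whole P _ = 0 , n≤0⇒n≡0 (reg P 0) , λ _ _ _ → tt
Open⇒OpenPart (inter {V} {W} oV oW) P (v , w) with Open⇒OpenPart oV P v | Open⇒OpenPart oW P w
... | k , Pk , nearV | l , Pl , nearW = k ⊔ l , min⊔ , λ Q Qm ag →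
    nearV Q (restrictMin Q Qm ag (m≤m⊔n k l) Pk) (Agree-≤ {A = Q} {P} (m≤m⊔n k l) ag) ,
    nearW Q (restrictMin Q Qm ag (m≤n⊔m k l) Pl) (Agree-≤ {A = Q} {P} (m≤n⊔m k l) ag)
  where
  min⊔ : Min P (k ⊔ l)
  min⊔ with ⊔-sel k l
  ... | inj₁ eq = subst (Min P) (sym eq) Pk
  ... | inj₂ eq = subst (Min P) (sym eq) Pl
  restrictMin : ∀ {j m} Q → Min Q m → Agree m Q P → j ≤ m → Min P j → Min Q j
  restrictMin Q Qm ag j≤m Pj with m≤n⇒m<n∨m≡n j≤m
  ... | inj₁ j<m  = trans (ag _ j<m) Pj
  ... | inj₂ refl = Qm
Open⇒OpenPart (union o) P (j , v) with Open⇒OpenPart (o j) P v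
... | k , Pk , near = k , Pk , λ Q Qk ag → j , near Q Qk ag
Open⇒OpenPart (resp (V⊆W , W⊆V) o) P w with Open⇒OpenPart o P (W⊆V w)
... | k , Pk , near = k , Pk , λ Q Qk ag → V⊆W (near Q Qk ag)

-- Borel sets are Ramsey, and Borel maps are tracial on a conull set.

module Tracial (em : ∀ {ℓ} → ExcludedMiddle ℓ) where
  open Ellentuck em

  Borel⇒Ramsey : ∀ {V} → Borel V → Ramsey (V ∘ fromPart)
  Borel⇒Ramsey {V} (generator o) = Ramsey-open λ C v → let k , Ck , near = Open⇒OpenPart o C v in
    k , Ck , λ D b → near D (min b) (agree b)
  Borel⇒Ramsey (complement b) = Ramsey-∁ (Borel⇒Ramsey b)
  Borel⇒Ramsey (union {V} b) = Ramsey-⋃ (λ n → Borel⇒Ramsey (b n))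
  Borel⇒Ramsey (resp (V⊆W , W⊆V) b) = Ramsey-resp V⊆W W⊆V (Borel⇒Ramsey b)

  Related : ℕ → ℕ → Pred E∞ 0ℓ
  Related i j A = T (E∞.χ A i j)

  -- A union of cylinders: every A has a minimum above i and j, and its restriction below that
  -- minimum decides whether they are related.
  Related-Open : ∀ i j → Open (Related i j)
  Related-Open i j = resp (to , from) (union {J = J} {V = Cylinder ∘ proj₁} (λ s → subbasic (proj₁ s)))
    where
    J : Set
    J = Σ[ s ∈ Efin ] Σ[ i< ∈ i < Efin.dom s ] Σ[ j< ∈ j < Efin.dom s ] T (Efin.χ s (fromℕ< i<) (fromℕ< j<))
    to : ∀ {A} → ∃[ s ] Cylinder (proj₁ s) A → Related i j A
    to {A} ((s , i< , j< , t) , n , refl , p) = subst T (sym (trans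
      (cong₂ (E∞.χ A) (sym (toℕ-fromℕ< i<)) (sym (toℕ-fromℕ< j<)))
      (trans (p (fromℕ< i<) (fromℕ< j<)) (cong₂ (Efin.χ s) (cast-is-id refl _) (cast-is-id refl _))))) t
    from : ∀ {A} → Related i j A → ∃[ s ] Cylinder (proj₁ s) A
    from {A} t with minimum-unbounded A (suc i ⊔ suc j)
    ... | m , ≤m , mm with μ-surjective A mm
    ...   | n , refl =
      index ,
      n , restrict-≈ {A} {A} refl (λ _ _ _ _ → refl)
      where
      i< : i < μ A n
      i< = m⊔n≤o⇒m≤o (suc i) (suc j) ≤m
      j< : j < μ A n
      j< = m⊔n≤o⇒n≤o (suc i) (suc j) ≤m
      related : T (E∞.χ A (toℕ (fromℕ< i<)) (toℕ (fromℕ< j<)))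
      related = subst T (cong₂ (E∞.χ A) (sym (toℕ-fromℕ< i<)) (sym (toℕ-fromℕ< j<))) t
      index : J
      index = r n A , i< , j< , related

  module _ (f : E∞-map) (f-Borel : BorelMap f) where

    fP : Part → E∞
    fP C = Func.to f (fromPart C)

    Bit : ℕ × ℕ → Part → Set
    Bit (i , j) C = T (E∞.χ (fP C) i j)

    Bit-Ramsey : ∀ ij → Ramsey (Bit ij)
    Bit-Ramsey (i , j) = Borel⇒Ramsey (f-Borel (Related i j) (generator (Related-Open i j)))

    -- Stated with the minimum k itself instead of its index in B, which makes passing to relations
    -- below B immediate.
    TracialAt : Part → Set
    TracialAt B = ∃[ k₀ ] ∀ {k C D} → k₀ ≤ k → C ⊑ B → D ⊑ B → Min C k → Min D k → Agree k D C →
      ∀ i j → i < k → j < k → E∞.χ (fP C) i j ≡ E∞.χ (fP D) i j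

    TracialAt-⊑ : ∀ {A B} → B ⊑ A → TracialAt A → TracialAt B
    TracialAt-⊑ {A} {B} B⊑A (k₀ , tra) = k₀ , λ {k} {C} {D} le C⊑ D⊑ →
      tra {k} {C} {D} le (⊑-trans {A} {B} {C} C⊑ B⊑A) (⊑-trans {A} {B} {D} D⊑ B⊑A)

    -- At depth k only the bits with i, j < k matter, so density is a matter of finitely many Ramsey
    -- sets.
    TracialAt-dense : ∀ {k A} → Min A k → ∃[ B ] Box k A B × TracialAt B
    TracialAt-dense {k₀} {A} Ak₀ with Fusion.fusion em A
      (λ k C → ∀ {ij} → ij ∈ cartesianProduct (upTo k) (upTo k) → Homogeneous (Bit ij) k C)
      (λ hom b ij∈ → Homogeneous-box (hom ij∈) b)
      (λ {k} _ Ck → Ramsey-simultaneous Bit-Ramsey (cartesianProduct (upTo k) (upTo k)) Ck) Ak₀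
    ... | B , b , hom = B , b , k₀ , λ {k} {C} {D} → bits {k} {C} {D}
      where
      bits : ∀ {k C D} → k₀ ≤ k → C ⊑ B → D ⊑ B → Min C k → Min D k → Agree k D C →
        ∀ i j → i < k → j < k → E∞.χ (fP C) i j ≡ E∞.χ (fP D) i j
      bits {k} {C} {D} k₀≤k C⊑ D⊑ Ck Dk ag i j i<k j<k =
        same (hom k₀≤k greatest-⊑ greatest-min (∈-cartesianProduct⁺ (∈-upTo⁺ i<k) (∈-upTo⁺ j<k)))
        where
        -- C and D have the same restriction to {0,...,k-1}, so both lie in the basic set of
        -- `greatest`, on which every bit is constant.
        open Greatest {k} {B} {C} C⊑ Ck
        boxC : Box k greatest C
        boxC = greatest-box C⊑ (λ _ _ → refl) Ck
        boxD : Box k greatest D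
        boxD = greatest-box D⊑ ag Dk
        same : Homogeneous (Bit (i , j)) k greatest → E∞.χ (fP C) i j ≡ E∞.χ (fP D) i j
        same (inj₁ all)  = T-ext (λ _ → all D boxD) (λ _ → all C boxC)
        same (inj₂ none) = T-ext (λ t → contradiction t (none C boxC)) (λ t → contradiction t (none D boxD))

    -- Taking all relations with the property reduces conullness to density and heredity.
    Conull : Pred E∞ 0ℓ
    Conull B = TracialAt (toPart B)

    ⇒-⊑ : ∀ {A B} → E∞._∼_ B ⇒ E∞._∼_ A → toPart A ⊑ toPart B
    ⇒-⊑ {A} {B} B⇒A x = rep-cong A (B⇒A (rep-∼ B x))

    Conull-resp : Conull Respects _≈_
    Conull-resp {A} {B} A≈B = TracialAt-⊑ {toPart A} {toPart B} (⇒-⊑ {B} {A} λ {i} {j} → subst T (A≈B i j))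

    Conull-RamseyConull : RamseyConull Conull
    Conull-RamseyConull s A (B₀ , B₀≼A , n , s≈) =
      -- Density is applied to the given member `B₀` at the minimum where its initial part s ends,
      -- so P still starts with s and lies below A.
      let P , b , tra = TracialAt-dense (rep-minimum B₀ (μ-isMinimum B₀ n)) in
      fromPart P , (C≼A b , s-initial b) , λ {D} → inside {P} tra {D}
      where
      k = μ B₀ n
      P₀ = toPart B₀
      module _ {P : Part} where
        C = fromPart P
        C≼A : Box k P₀ P → C ≼ A
        C≼A b = Equivalence.from (≼⇔⇒ C A) λ {i} {j} i∼j → fromWitness (begin
          at P i              ≡⟨ sym (below b i) ⟩
          at P (rep B₀ i)     ≡⟨ cong (at P) (rep-cong B₀ (Equivalence.to (≼⇔⇒ B₀ A) B₀≼A i∼j)) ⟩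
          at P (rep B₀ j)     ≡⟨ below b j ⟩
          at P j              ∎)
          where open ≡-Reasoning
        s-initial : Box k P₀ P → ∃[ m ] s ≈fin r m C
        s-initial b with μ-surjective C (Min⇒IsMinimum P (min b))
        ... | m , eq = m , ≈fin-trans {s} {r n B₀} {r m C} s≈
          (restrict-≈ {B₀} {C} (sym eq) λ i j i<k j<k →
            trans (from-to B₀ i j) (sym (Agree⇒χ {_} {P} {P₀} (agree b) i j i<k j<k)))
        inside : TracialAt P → ⟦ s , C ⟧ ⊆ Conull
        inside tra {D} (D≼C , _) = TracialAt-⊑ {P} {toPart D}
          (λ x → rep-cong D (Equivalence.to (≼⇔⇒ D C) D≼C (fromWitness (idem P x)))) tra

    Conull-Tracial : TracialOn f Conull
    -- The bound on minima also serves as the bound on indices, since `n ≤ μ B n`.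
    Conull-Tracial B (k₀ , tra) = k₀ , λ { n k₀≤n A A′ A≼B A′≼B (k , s , s≈ , s≈′ , dom≡) →
      let eq = trans (sym (proj₁ s≈)) dom≡
          eq′ = trans (sym (proj₁ s≈′)) dom≡
          agA : ∀ i j → i < μ B n → j < μ B n → E∞.χ A′ i j ≡ E∞.χ A i j
          agA i j i< j< = ≈-restrict {A′} {A} (≈fin-trans {r k A′} {s} {r k A} (≈fin-sym {s} {r k A′} s≈′) s≈)
            i j (subst (i <_) (sym eq′) i<) (subst (j <_) (sym eq′) j<)
      in restrict-≈ {Func.to f A} {Func.to f A′} refl λ i j i< j< →
        trans (Func.cong f (from-to A) i j) (trans
          (tra {C = toPart A} {toPart A′} (≤-trans k₀≤n (n≤μ B n))
            (⇒-⊑ {A} {B} (Equivalence.to (≼⇔⇒ A B) A≼B)) (⇒-⊑ {A′} {B} (Equivalence.to (≼⇔⇒ A′ B) A′≼B))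
            (rep-minimum A (subst (IsMinimum A) eq (μ-isMinimum A k)))
            (rep-minimum A′ (subst (IsMinimum A′) eq′ (μ-isMinimum A′ k)))
            (rep-agree {A′} {A} agA) i j i< j<)
          (sym (Func.cong f (from-to A′) i j))) }
      where
      n≤μ : ∀ A n → n ≤ μ A n
      n≤μ A zero    = z≤n
      n≤μ A (suc n) = ≤-<-trans (n≤μ A n) (μ-increasing A n)
      rep-agree : ∀ {A B k} → (∀ i j → i < k → j < k → E∞.χ A i j ≡ E∞.χ B i j) → Agree k (toPart A) (toPart B)
      rep-agree {A} {B} eq x x<k = ≤-antisym
        (rep-least A (subst T (sym (eq (rep B x) x (≤-<-trans (reg (toPart B) x) x<k) x<k)) (rep-∼ B x)))
        (rep-least B (subst T (eq (rep A x) x (≤-<-trans (reg (toPart A) x) x<k) x<k) (rep-∼ A x)))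

lemma5p2 : (∀ {ℓ} → ExcludedMiddle ℓ) →
    (f : E∞-map) → BorelMap f →
    Σ[ C ∈ Pred E∞ 0ℓ ] (C Respects _≈_ × RamseyConull C × TracialOn f C)
lemma5p2 em f bf = Tracial.Conull em f bf , (λ {A} {B} → Tracial.Conull-resp em f bf {A} {B}) ,
  Tracial.Conull-RamseyConull em f bf , Tracial.Conull-Tracial em f bf
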